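{- If $0<\epsilon \leq 1/2$ and $k \geq 2$ is an integer, then $n(k,\epsilon)> \epsilon^{ -(k-1)/2}$.
   Context: $\mathcal{F}_k$ denotes the family of $2$-edge-colored complete graphs on $2k$ vertices in which one of the two colors forms either a clique of order $k$ or two disjoint cliques of order $k$ (that is, the edges of that color are exactly the edges of a complete graph on some $k$ of the $2k$ vertices, or exactly the edges of two complete graphs on complementary sets of $k$ vertices each; all other edges have the other color). A $2$-edge-coloring of $K_n$ contains a member of $\mathcal{F}_k$ if there are $2k$ vertices on which the induced $2$-edge-colored complete graph is a member of $\mathcal{F}_k$. $n(k,\epsilon)$ denotes the minimum $n_0$ such that every $2$-edge-coloring of the complete graph $K_n$ with $n \geq n_0$ which has at least $\epsilon\binom{n}{2}$ edges in each color contains a member of $\mathcal{F}_k$. Throughout the paper, floor and ceiling signs are systematically omitted whenever they are not crucial. -}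

module Defs where

open import Data.Bool using (Bool)
import Data.Bool as Bool
open import Data.Empty using (⊥; ⊥-elim)
open import Data.Fin using (Fin)
import Data.Fin as Fin
import Data.Fin.Properties as Fin
open import Data.Fin.Subset using (Subset; ∣_∣; ∁) renaming (_∈_ to _∈ˢ_)
open import Data.Integer using (+_; +≤+)
import Data.Integer as ℤ
import Data.Integer.Properties as ℤ
open import Data.List using (List; length; filter; cartesianProduct; allFin)
open import Data.Nat using (ℕ; zero; suc)
import Data.Nat as ℕ
import Data.Nat.Properties as ℕ
open import Data.Nat.Combinatorics using (_C_)
open import Data.Product using (Σ-syntax; ∃; ∃-syntax; ∃₂; _×_; _,_; proj₁; proj₂)
open import Data.Rational hiding (∣_∣)
open import Data.Rational.Properties
open import Data.Rational.Solver using (module +-*-Solver)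
import Data.Rational.Unnormalised as ℚᵘ
import Data.Rational.Unnormalised.Properties as ℚᵘ
open import Data.Sum using (_⊎_; inj₁; inj₂)
open import Function using (_↣_; _⇔_; Injection)
open import Relation.Binary.PropositionalEquality using (_≡_; _≢_; refl; sym; trans; cong; subst; subst₂)
open import Relation.Nullary using (Dec; yes; no)

ratio : ℕ → ℚ
ratio n = + n / 1

0<1 : 0ℚ < 1ℚ
0<1 = positive⁻¹ 1ℚ

p<q⇒0<q-p : ∀ {p q} → p < q → 0ℚ < q - p
p<q⇒0<q-p {p} {q} p<q = subst (_< q - p) (+-inverseʳ p) (+-monoˡ-< (- p) p<q)

p<p+q : ∀ p {q} → 0ℚ < q → p < p + q
p<p+q p {q} 0<q = subst (_< p + q) (+-identityʳ p) (+-monoʳ-< p 0<q)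

p≤p+q : ∀ p {q} → 0ℚ ≤ q → p ≤ p + q
p≤p+q p {q} 0≤q = subst (_≤ p + q) (+-identityʳ p) (+-monoʳ-≤ p 0≤q)

p-1<p : ∀ p → p - 1ℚ < p
p-1<p p = subst (p - 1ℚ <_) (+-identityʳ p) (+-monoʳ-< p (negative⁻¹ (- 1ℚ)))

*-monoˡ-≤ : ∀ r {p q} → 0ℚ ≤ r → p ≤ q → p * r ≤ q * r
*-monoˡ-≤ r 0≤r = *-monoʳ-≤-nonNeg r {{nonNegative 0≤r}}

*-monoʳ-≤ : ∀ r {p q} → 0ℚ ≤ r → p ≤ q → r * p ≤ r * q
*-monoʳ-≤ r 0≤r = *-monoˡ-≤-nonNeg r {{nonNegative 0≤r}}

*-monoˡ-< : ∀ r {p q} → 0ℚ < r → p < q → p * r < q * r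
*-monoˡ-< r 0<r = *-monoˡ-<-pos r {{positive 0<r}}

*-monoʳ-< : ∀ r {p q} → 0ℚ < r → p < q → r * p < r * q
*-monoʳ-< r 0<r = *-monoʳ-<-pos r {{positive 0<r}}

*-cancelʳ-< : ∀ r {p q} → 0ℚ < r → p * r < q * r → p < q
*-cancelʳ-< r 0<r = *-cancelʳ-<-nonNeg r {{nonNegative (<⇒≤ 0<r)}}

*-pos : ∀ {p q} → 0ℚ < p → 0ℚ < q → 0ℚ < p * q
*-pos {p} {q} 0<p 0<q = subst (_< p * q) (*-zeroˡ q) (*-monoˡ-< q 0<q 0<p)

*-nonNeg : ∀ {p q} → 0ℚ ≤ p → 0ℚ ≤ q → 0ℚ ≤ p * q
*-nonNeg {p} {q} 0≤p 0≤q = subst (_≤ p * q) (*-zeroˡ q) (*-monoˡ-≤ q 0≤q 0≤p)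

p²≥0 : ∀ p → 0ℚ ≤ p * p
p²≥0 p with ≤-total 0ℚ p
... | inj₁ 0≤p = *-nonNeg 0≤p 0≤p
... | inj₂ p≤0 = subst (_≤ p * p) (*-zeroˡ p) (*-monoʳ-≤-nonPos p {{nonPositive p≤0}} p≤0)

p²<q² : ∀ {p q} → 0ℚ ≤ p → p < q → p * p < q * q
p²<q² {p} {q} 0≤p p<q =
  ≤-<-trans (*-monoʳ-≤ p 0≤p (<⇒≤ p<q)) (*-monoˡ-< q (≤-<-trans 0≤p p<q) p<q)

reciprocal : ∀ {p} → 0ℚ < p → Σ[ r ∈ ℚ ] 0ℚ < r × r * p ≡ 1ℚ
reciprocal {p} 0<p = r , positive⁻¹ r {{1/pos⇒pos p}} , *-inverseˡ p
  where
  instance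
    p-pos : Positive p
    p-pos = positive 0<p
    p-nz : NonZero p
    p-nz = pos⇒nonZero p
  r = 1/ p

quotient : ∀ w {p} → 0ℚ < p → Σ[ r ∈ ℚ ] r * p ≡ w
quotient w {p} 0<p with reciprocal 0<p
... | r , _ , rp≡1 =
  w * r , trans (*-assoc w r p) (trans (cong (w *_) rp≡1) (*-identityʳ w))

<-⊓ : ∀ {p q r} → p < q → p < r → p < q ⊓ r
<-⊓ {p} {q} {r} p<q p<r with ⊓-sel q r
... | inj₁ e = subst (p <_) (sym e) p<q
... | inj₂ e = subst (p <_) (sym e) p<r

⊔-< : ∀ {p q r} → q < p → r < p → q ⊔ r < p
⊔-< {p} {q} {r} q<p r<p with ⊔-sel q r
... | inj₁ e = subst (_< p) (sym e) q<p
... | inj₂ e = subst (_< p) (sym e) r<p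

ratio-suc : ∀ n → ratio (suc n) ≡ 1ℚ + ratio n
ratio-suc n = toℚᵘ-injective (begin
  toℚᵘ (ratio (suc n))               ≈⟨ toℚᵘ-fromℚᵘ (ℚᵘ.mkℚᵘ (+ suc n) 0) ⟩
  ℚᵘ.mkℚᵘ (+ suc n) 0                ≈⟨ ℚᵘ.*≡* (cross (+ n)) ⟩
  ℚᵘ.1ℚᵘ ℚᵘ.+ ℚᵘ.mkℚᵘ (+ n) 0        ≈⟨ ℚᵘ.+-congʳ ℚᵘ.1ℚᵘ (toℚᵘ-fromℚᵘ (ℚᵘ.mkℚᵘ (+ n) 0)) ⟨
  ℚᵘ.1ℚᵘ ℚᵘ.+ toℚᵘ (ratio n)         ≈⟨ toℚᵘ-homo-+ 1ℚ (ratio n) ⟨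
  toℚᵘ (1ℚ + ratio n)                ∎)
  where
  open ℚᵘ.≃-Reasoning
  cross : ∀ m → (+ 1 ℤ.+ m) ℤ.* + 1 ≡ (+ 1 ℤ.+ m ℤ.* + 1) ℤ.* + 1
  cross m = cong (λ k → (+ 1 ℤ.+ k) ℤ.* + 1) (sym (ℤ.*-identityʳ m))

ratio-bound : ∀ p → p ≤ ratio ℤ.∣ ↥ p ∣
ratio-bound p = toℚᵘ-cancel-≤ (ℚᵘ.≤-respʳ-≃ (ℚᵘ.≃-sym (toℚᵘ-fromℚᵘ (ℚᵘ.mkℚᵘ (+ ℤ.∣ ↥ p ∣) 0))) (go p))
  where
  go : ∀ p → toℚᵘ p ℚᵘ.≤ ℚᵘ.mkℚᵘ (+ ℤ.∣ ↥ p ∣) 0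
  go (mkℚ (+ n) d _) = ℚᵘ.*≤* (ℤ.*-monoˡ-≤-nonNeg (+ n) (+≤+ (ℕ.s≤s ℕ.z≤n)))
  go (mkℚ ℤ.-[1+ n ] d _) = ℚᵘ.*≤* ℤ.-≤+

multiple : ℕ → ℚ → ℚ
multiple zero    h = 0ℚ
multiple (suc n) h = h + multiple n h

multiple≡ : ∀ n h → multiple n h ≡ ratio n * h
multiple≡ zero    h = sym (*-zeroˡ h)
multiple≡ (suc n) h = trans (cong (λ z → h + z) (multiple≡ n h))
  (trans (solve 2 (λ h r → h :+ r :* h := (con 1ℚ :+ r) :* h) refl h (ratio n))
         (cong (_* h) (sym (ratio-suc n))))
  where open +-*-Solver

archimedean : ∀ D {h} → 0ℚ < h → ∃[ n ] D ≤ multiple n h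
archimedean D {h} 0<h with quotient D 0<h
... | r , rh≡D = n , subst₂ _≤_ rh≡D (sym (multiple≡ n h)) (*-monoˡ-≤ h (<⇒≤ 0<h) (ratio-bound r))
  where n = ℤ.∣ ↥ r ∣

-- Two-sided Dedekind cuts: L is the set of rationals below the number and U
-- the set of rationals above it.
record ℝ : Set₁ where
  field
    L U     : ℚ → Set
    L-inh   : ∃ L
    U-inh   : ∃ U
    L-down  : ∀ {p q} → p < q → L q → L p
    U-up    : ∀ {p q} → p < q → U p → U q
    L-open  : ∀ {p} → L p → ∃[ q ] p < q × L q
    U-open  : ∀ {q} → U q → ∃[ p ] p < q × U p
    disjoint : ∀ {q} → L q → U q → ⊥
    located : ∀ {p q} → p < q → L p ⊎ U q

open ℝ

infix 4 _<ᴿ_ _≤ᴿ_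
infixl 7 _*ᴿ_
infixr 8 _^ᴿ_

_<ᴿ_ : ℝ → ℝ → Set
x <ᴿ y = ∃[ q ] U x q × L y q

_≤ᴿ_ : ℝ → ℝ → Set
x ≤ᴿ y = ∀ q → L x q → L y q

fromℚ : ℚ → ℝ
fromℚ r = record
  { L        = _< r
  ; U        = r <_
  ; L-inh    = r - 1ℚ , p-1<p r
  ; U-inh    = r + 1ℚ , p<p+q r 0<1
  ; L-down   = <-trans
  ; U-up     = λ p<q r<p → <-trans r<p p<q
  ; L-open   = λ p<r → let (m , p<m , m<r) = <-dense p<r in m , p<m , m<r
  ; U-open   = λ r<q → let (m , r<m , m<q) = <-dense r<q in m , m<q , r<m
  ; disjoint = <-asym
  ; located  = loc
  }
  where
  loc : ∀ {p q} → p < q → p < r ⊎ r < q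
  loc {p} p<q with p <? r
  ... | yes p<r = inj₁ p<r
  ... | no  p≮r = inj₂ (≤-<-trans (≮⇒≥ p≮r) p<q)

fromℕ : ℕ → ℝ
fromℕ n = fromℚ (ratio n)

L-≤ : ∀ x {p q} → p ≤ q → L x q → L x p
L-≤ x p≤q Lq = let (r , q<r , Lr) = L-open x Lq in L-down x (≤-<-trans p≤q q<r) Lr

U-≤ : ∀ x {p q} → p ≤ q → U x p → U x q
U-≤ x p≤q Up = let (r , r<p , Ur) = U-open x Up in U-up x (<-≤-trans r<p p≤q) Ur

L<U : ∀ x {p q} → L x p → U x q → p < q
L<U x {p} {q} Lp Uq with p <? q
... | yes p<q = p<q
... | no  p≮q = ⊥-elim (disjoint x (L-≤ x (≮⇒≥ p≮q) Lp) Uq)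

bounded : ∀ x → ∃[ M ] 0ℚ ≤ M × L x (- M) × U x M
bounded x with L-inh x | U-inh x
... | a , La | b , Ub = M , p≤q⊔p (- a ⊔ b) 0ℚ , L-≤ x -M≤a La , U-≤ x b≤M Ub
  where
  M = (- a ⊔ b) ⊔ 0ℚ
  b≤M : b ≤ M
  b≤M = ≤-trans (p≤q⊔p (- a) b) (p≤p⊔q (- a ⊔ b) 0ℚ)
  -a≤M : - a ≤ M
  -a≤M = ≤-trans (p≤p⊔q (- a) b) (p≤p⊔q (- a ⊔ b) 0ℚ)
  -M≤a : - M ≤ a
  -M≤a = subst (- M ≤_) (solve 1 (λ a → :- (:- a) := a) refl a) (neg-antimono-≤ -a≤M)
    where open +-*-Solver

approximate : ∀ x {a₀ η} → L x a₀ → 0ℚ < η → ∃[ a ] a₀ ≤ a × L x a × U x (a + η)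
approximate x {a₀} {η} La₀ 0<η with U-inh x
... | b₀ , Ub₀ = start (archimedean (b₀ - a₀) 0<h)
  where
  h = ½ * η
  0<h : 0ℚ < h
  0<h = *-pos (positive⁻¹ ½) 0<η
  loop : ∀ n a → L x a → U x (a + multiple n h) → ∃[ a′ ] a ≤ a′ × L x a′ × U x (a′ + η)
  loop zero a La Ua = ⊥-elim (disjoint x La (subst (U x) (+-identityʳ a) Ua))
  loop (suc n) a La Ua = step (located x (+-monoʳ-< a h<η))
    where
    h<η : h < η
    h<η = subst₂ _<_ (+-identityʳ h) (solve 1 (λ e → con ½ :* e :+ con ½ :* e := e) refl η) (+-monoʳ-< h 0<h)
      where open +-*-Solver
    step : L x (a + h) ⊎ U x (a + η) → ∃[ a′ ] a ≤ a′ × L x a′ × U x (a′ + η)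
    step (inj₂ Ua+η) = a , ≤-refl , La , Ua+η
    step (inj₁ La+h) =
      let (a′ , a+h≤a′ , La′ , Ua′) = loop n (a + h) La+h (subst (U x) (sym (+-assoc a h (multiple n h))) Ua)
      in a′ , ≤-trans (p≤p+q a (<⇒≤ 0<h)) a+h≤a′ , La′ , Ua′
  start : ∃[ n ] b₀ - a₀ ≤ multiple n h → ∃[ a ] a₀ ≤ a × L x a × U x (a + η)
  start (n , D≤) = loop n a₀ La₀ (U-≤ x b₀≤ Ub₀)
    where
    b₀≤ : b₀ ≤ a₀ + multiple n h
    b₀≤ = subst (_≤ a₀ + multiple n h)
      (solve 2 (λ a b → a :+ (b :- a) := b) refl a₀ b₀) (+-monoʳ-≤ a₀ D≤)
      where open +-*-Solver

-- Least and greatest value of the product on the rectangle [a , b] × [c , d].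
min-corner max-corner : (a b c d : ℚ) → ℚ
min-corner a b c d = ((a * c) ⊓ (a * d)) ⊓ ((b * c) ⊓ (b * d))
max-corner a b c d = ((a * c) ⊔ (a * d)) ⊔ ((b * c) ⊔ (b * d))

segment : ∀ {a b} s t → a ≤ s → s ≤ b → (a * t) ⊓ (b * t) ≤ s * t × s * t ≤ (a * t) ⊔ (b * t)
segment {a} {b} s t a≤s s≤b with ≤-total 0ℚ t
... | inj₁ 0≤t = ≤-trans (p⊓q≤p (a * t) (b * t)) (*-monoˡ-≤ t 0≤t a≤s)
               , ≤-trans (*-monoˡ-≤ t 0≤t s≤b) (p≤q⊔p (a * t) (b * t))
... | inj₂ t≤0 = ≤-trans (p⊓q≤q (a * t) (b * t)) (*-monoʳ-≤-nonPos t {{nonPositive t≤0}} s≤b)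
               , ≤-trans (*-monoʳ-≤-nonPos t {{nonPositive t≤0}} a≤s) (p≤p⊔q (a * t) (b * t))

segment′ : ∀ {c d} s t → c ≤ t → t ≤ d → (s * c) ⊓ (s * d) ≤ s * t × s * t ≤ (s * c) ⊔ (s * d)
segment′ {c} {d} s t c≤t t≤d with segment t s c≤t t≤d
... | l , u rewrite *-comm s c | *-comm s d | *-comm s t = l , u

rectangle : ∀ {a b c d} s t → a ≤ s → s ≤ b → c ≤ t → t ≤ d →
            min-corner a b c d ≤ s * t × s * t ≤ max-corner a b c d
rectangle {a} {b} s t a≤s s≤b c≤t t≤d =
    ≤-trans (⊓-mono-≤ (proj₁ (segment′ a t c≤t t≤d)) (proj₁ (segment′ b t c≤t t≤d))) (proj₁ (segment s t a≤s s≤b))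
  , ≤-trans (proj₂ (segment s t a≤s s≤b)) (⊔-mono-≤ (proj₂ (segment′ a t c≤t t≤d)) (proj₂ (segment′ b t c≤t t≤d)))

-- Interval multiplication: q lies below (above) x y when some rational rectangle
-- around (x , y) has all its products above (below) q.
_*ᴿ_ : ℝ → ℝ → ℝ
x *ᴿ y = record
  { L        = Lᵖ
  ; U        = Uᵖ
  ; L-inh    = _ , _ , _ , _ , _ , some-box , p-1<p _
  ; U-inh    = _ , _ , _ , _ , _ , some-box , p<p+q _ 0<1
  ; L-down   = λ { p<q (a , b , c , d , box , q<m) → a , b , c , d , box , <-trans p<q q<m }
  ; U-up     = λ { p<q (a , b , c , d , box , m<p) → a , b , c , d , box , <-trans m<p p<q }
  ; L-open   = λ { (a , b , c , d , box , p<m) → let (q , p<q , q<m) = <-dense p<m in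
                   q , p<q , a , b , c , d , box , q<m }
  ; U-open   = λ { (a , b , c , d , box , m<q) → let (p , m<p , p<q) = <-dense m<q in
                   p , p<q , a , b , c , d , box , m<p }
  ; disjoint = disj
  ; located  = loc
  }
  where
  Box : (a b c d : ℚ) → Set
  Box a b c d = L x a × U x b × L y c × U y d

  Lᵖ Uᵖ : ℚ → Set
  Lᵖ q = ∃[ a ] ∃[ b ] ∃[ c ] ∃[ d ] Box a b c d × q < min-corner a b c d
  Uᵖ q = ∃[ a ] ∃[ b ] ∃[ c ] ∃[ d ] Box a b c d × max-corner a b c d < q

  some-box : Box (proj₁ (L-inh x)) (proj₁ (U-inh x)) (proj₁ (L-inh y)) (proj₁ (U-inh y))
  some-box = proj₂ (L-inh x) , proj₂ (U-inh x) , proj₂ (L-inh y) , proj₂ (U-inh y)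

  L-⊔ : ∀ z {p q} → L z p → L z q → L z (p ⊔ q)
  L-⊔ z {p} {q} Lp Lq with ⊔-sel p q
  ... | inj₁ e = subst (L z) (sym e) Lp
  ... | inj₂ e = subst (L z) (sym e) Lq

  disj : ∀ {q} → Lᵖ q → Uᵖ q → ⊥
  disj (a , b , c , d , (La , Ub , Lc , Ud) , q<m) (a′ , b′ , c′ , d′ , (La′ , Ub′ , Lc′ , Ud′) , m<q) =
    <-irrefl refl (<-trans (<-≤-trans q<m (proj₁ r)) (≤-<-trans (proj₂ r′) m<q))
    where
    Ls = L-⊔ x La La′
    Lt = L-⊔ y Lc Lc′
    r  = rectangle (a ⊔ a′) (c ⊔ c′) (p≤p⊔q a a′) (<⇒≤ (L<U x Ls Ub)) (p≤p⊔q c c′) (<⇒≤ (L<U y Lt Ud))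
    r′ = rectangle (a ⊔ a′) (c ⊔ c′) (p≤q⊔p a a′) (<⇒≤ (L<U x Ls Ub′)) (p≤q⊔p c c′) (<⇒≤ (L<U y Lt Ud′))

  loc : ∀ {p q} → p < q → Lᵖ p ⊎ Uᵖ q
  loc {p} {q} p<q = go (bounded x) (bounded y)
    where
    go : ∃[ M ] 0ℚ ≤ M × L x (- M) × U x M → ∃[ N ] 0ℚ ≤ N × L y (- N) × U y N → Lᵖ p ⊎ Uᵖ q
    go (M , 0≤M , L-M , UM) (N , 0≤N , L-N , UN) = decide (p + δ <? z)
      where
      open +-*-Solver
      δ = ½ * (q - p)
      0<δ : 0ℚ < δ
      0<δ = *-pos (positive⁻¹ ½) (p<q⇒0<q-p p<q)
      K = M + N + 1ℚ
      0≤M+N : 0ℚ ≤ M + N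
      0≤M+N = ≤-trans 0≤M (p≤p+q M 0≤N)
      1≤K : 1ℚ ≤ K
      1≤K = subst (1ℚ ≤_) (+-comm 1ℚ (M + N)) (p≤p+q 1ℚ 0≤M+N)
      0<K : 0ℚ < K
      0<K = <-≤-trans 0<1 1≤K
      δ′ = δ ⊓ 1ℚ
      0<δ′ : 0ℚ < δ′
      0<δ′ = <-⊓ 0<δ 0<1
      η : ℚ
      η = proj₁ (quotient δ′ 0<K)
      ηK≡δ′ : η * K ≡ δ′
      ηK≡δ′ = proj₂ (quotient δ′ 0<K)
      0<η : 0ℚ < η
      0<η = *-cancelʳ-< K 0<K (subst₂ _<_ (sym (*-zeroˡ K)) (sym ηK≡δ′) 0<δ′)
      η≤1 : η ≤ 1ℚ
      η≤1 = ≤-trans (subst (_≤ η * K) (*-identityʳ η) (*-monoʳ-≤ η (<⇒≤ 0<η) 1≤K))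
                    (subst (_≤ 1ℚ) (sym ηK≡δ′) (p⊓q≤q δ 1ℚ))
      A = approximate x L-M 0<η
      B = approximate y L-N 0<η
      a = proj₁ A
      c = proj₁ B
      b = a + η
      d = c + η
      box : Box a b c d
      box = proj₁ (proj₂ (proj₂ A)) , proj₂ (proj₂ (proj₂ A)) , proj₁ (proj₂ (proj₂ B)) , proj₂ (proj₂ (proj₂ B))
      -M≤a : - M ≤ a
      -M≤a = proj₁ (proj₂ A)
      -N≤c : - N ≤ c
      -N≤c = proj₁ (proj₂ B)
      a<M : a < M
      a<M = L<U x (proj₁ box) UM
      c<N : c < N
      c<N = L<U y (proj₁ (proj₂ (proj₂ box))) UN
      M≤K : M ≤ K
      M≤K = subst (M ≤_) (sym (+-assoc M N 1ℚ)) (p≤p+q M (≤-trans 0≤N (p≤p+q N (<⇒≤ 0<1))))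
      N≤K : N ≤ K
      N≤K = subst (N ≤_) (solve 2 (λ M N → N :+ (M :+ con 1ℚ) := M :+ N :+ con 1ℚ) refl M N)
                         (p≤p+q N (≤-trans 0≤M (p≤p+q M (<⇒≤ 0<1))))
      z = a * c
      lower : ∀ v → - K ≤ v → z - δ ≤ z + η * v
      lower v -K≤v = +-monoʳ-≤ z (≤-trans (neg-antimono-≤ (p⊓q≤p δ 1ℚ))
        (subst (_≤ η * v) (trans (sym (neg-distribʳ-* η K)) (cong -_ ηK≡δ′)) (*-monoʳ-≤ η (<⇒≤ 0<η) -K≤v)))
      upper : ∀ v → v < K → z + η * v < z + δ
      upper v v<K = +-monoʳ-< z (<-≤-trans (subst (η * v <_) ηK≡δ′ (*-monoʳ-< η 0<η v<K)) (p⊓q≤p δ 1ℚ))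
      v₃ = a + c + η
      -K≤0 : - K ≤ 0ℚ
      -K≤0 = neg-antimono-≤ (<⇒≤ 0<K)
      -K≤a : - K ≤ a
      -K≤a = ≤-trans (neg-antimono-≤ M≤K) -M≤a
      -K≤c : - K ≤ c
      -K≤c = ≤-trans (neg-antimono-≤ N≤K) -N≤c
      -K≤v₃ : - K ≤ v₃
      -K≤v₃ = ≤-trans (neg-antimono-≤ (p≤p+q (M + N) (<⇒≤ 0<1)))
        (subst (_≤ v₃) (solve 2 (λ M N → (:- M :+ :- N) :+ con 0ℚ := :- (M :+ N)) refl M N)
          (+-mono-≤ (+-mono-≤ -M≤a -N≤c) (<⇒≤ 0<η)))
      v₃<K : v₃ < K
      v₃<K = +-mono-<-≤ (+-mono-< a<M c<N) η≤1
      e₁ : z + η * 0ℚ ≡ a * c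
      e₁ = solve 3 (λ a c η → a :* c :+ η :* con 0ℚ := a :* c) refl a c η
      e₂ : z + η * a ≡ a * d
      e₂ = solve 3 (λ a c η → a :* c :+ η :* a := a :* (c :+ η)) refl a c η
      e₃ : z + η * c ≡ b * c
      e₃ = solve 3 (λ a c η → a :* c :+ η :* c := (a :+ η) :* c) refl a c η
      e₄ : z + η * v₃ ≡ b * d
      e₄ = solve 3 (λ a c η → a :* c :+ η :* (a :+ c :+ η) := (a :+ η) :* (c :+ η)) refl a c η
      decide : Dec (p + δ < z) → Lᵖ p ⊎ Uᵖ q
      decide (yes p+δ<z) = inj₁ (a , b , c , d , box ,
              <-⊓ (<-⊓ (lo _ e₁ -K≤0) (lo _ e₂ -K≤a)) (<-⊓ (lo _ e₃ -K≤c) (lo _ e₄ -K≤v₃)))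
        where
        p<z-δ : p < z - δ
        p<z-δ = subst (_< z - δ) (solve 2 (λ p δ → p :+ δ :- δ := p) refl p δ) (+-monoˡ-< (- δ) p+δ<z)
        lo : ∀ v {w} → z + η * v ≡ w → - K ≤ v → p < w
        lo v e -K≤v = subst (p <_) e (<-≤-trans p<z-δ (lower v -K≤v))
      decide (no p+δ≮z) = inj₂ (a , b , c , d , box ,
              ⊔-< (⊔-< (hi _ e₁ 0<K) (hi _ e₂ (<-≤-trans a<M M≤K))) (⊔-< (hi _ e₃ (<-≤-trans c<N N≤K)) (hi _ e₄ v₃<K)))
        where
        z+δ≤q : z + δ ≤ q
        z+δ≤q = subst (z + δ ≤_)
          (solve 2 (λ p q → p :+ con ½ :* (q :- p) :+ con ½ :* (q :- p) := q) refl p q)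
          (+-monoˡ-≤ δ (≮⇒≥ p+δ≮z))
        hi : ∀ v {w} → z + η * v ≡ w → v < K → w < q
        hi v e v<K = subst (_< q) e (<-≤-trans (upper v v<K) z+δ≤q)

_^ᴿ_ : ℝ → ℕ → ℝ
x ^ᴿ zero  = fromℚ 1ℚ
x ^ᴿ suc m = x *ᴿ x ^ᴿ m

-- For x > 0: q < 1/x iff q r < 1 for some r > x, and q > 1/x iff q s > 1 for some
-- 0 < s < x.
inverse : (x : ℝ) → fromℚ 0ℚ <ᴿ x → ℝ
inverse x (s₀ , 0<s₀ , Ls₀) = record
  { L        = Lⁱ
  ; U        = Uⁱ
  ; L-inh    = 0ℚ , proj₁ (U-inh x) , proj₂ (U-inh x) , subst (_< 1ℚ) (sym (*-zeroˡ (proj₁ (U-inh x)))) 0<1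
  ; U-inh    = let (r , rs≡2) = quotient (1ℚ + 1ℚ) 0<s₀ in
               r , s₀ , Ls₀ , 0<s₀ , subst (1ℚ <_) (sym rs≡2) (p<p+q 1ℚ 0<1)
  ; L-down   = λ { p<q (r , Ur , qr<1) → r , Ur , <-trans (*-monoˡ-< r (U-pos Ur) p<q) qr<1 }
  ; U-up     = λ { p<q (s , Ls , 0<s , 1<ps) → s , Ls , 0<s , <-trans 1<ps (*-monoˡ-< s 0<s p<q) }
  ; L-open   = λ { (r , Ur , pr<1) →
                   let (w , pr<w , w<1) = <-dense pr<1
                       (q , qr≡w) = quotient w (U-pos Ur)
                   in q , *-cancelʳ-< r (U-pos Ur) (subst (_ <_) (sym qr≡w) pr<w)
                    , r , Ur , subst (_< 1ℚ) (sym qr≡w) w<1 }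
  ; U-open   = λ { (s , Ls , 0<s , 1<qs) →
                   let (w , 1<w , w<qs) = <-dense 1<qs
                       (p , ps≡w) = quotient w 0<s
                   in p , *-cancelʳ-< s 0<s (subst (_< _) (sym ps≡w) w<qs)
                    , s , Ls , 0<s , subst (1ℚ <_) (sym ps≡w) 1<w }
  ; disjoint = λ {q} → disj q
  ; located  = loc
  }
  where
  Lⁱ Uⁱ : ℚ → Set
  Lⁱ q = ∃[ r ] U x r × q * r < 1ℚ
  Uⁱ q = ∃[ s ] L x s × 0ℚ < s × 1ℚ < q * s

  U-pos : ∀ {r} → U x r → 0ℚ < r
  U-pos Ur = <-trans 0<s₀ (L<U x Ls₀ Ur)

  disj : ∀ q → Lⁱ q → Uⁱ q → ⊥
  disj q (r , Ur , qr<1) (s , Ls , 0<s , 1<qs) =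
    <-asym 1<qs (<-trans (*-monoʳ-< q 0<q (L<U x Ls Ur)) qr<1)
    where
    0<q : 0ℚ < q
    0<q = *-cancelʳ-< s 0<s (subst (_< q * s) (sym (*-zeroˡ s)) (<-trans 0<1 1<qs))

  loc : ∀ {p q} → p < q → Lⁱ p ⊎ Uⁱ q
  loc {p} {q} p<q with 0ℚ <? p
  ... | no 0≮p = inj₁ (r , Ur , ≤-<-trans pr≤0 0<1)
    where
    r  = proj₁ (U-inh x)
    Ur = proj₂ (U-inh x)
    pr≤0 : p * r ≤ 0ℚ
    pr≤0 = subst (p * r ≤_) (*-zeroˡ r) (*-monoˡ-≤ r (<⇒≤ (U-pos Ur)) (≮⇒≥ 0≮p))
  ... | yes 0<p = go (reciprocal 0<p) (reciprocal 0<q)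
    where
    0<q : 0ℚ < q
    0<q = <-trans 0<p p<q
    go : Σ[ p⁻¹ ∈ ℚ ] 0ℚ < p⁻¹ × p⁻¹ * p ≡ 1ℚ → Σ[ q⁻¹ ∈ ℚ ] 0ℚ < q⁻¹ × q⁻¹ * q ≡ 1ℚ → Lⁱ p ⊎ Uⁱ q
    go (p⁻¹ , 0<p⁻¹ , p⁻¹p≡1) (q⁻¹ , 0<q⁻¹ , q⁻¹q≡1) = split (located x q⁻¹<p⁻¹)
      where
      q⁻¹<p⁻¹ : q⁻¹ < p⁻¹
      q⁻¹<p⁻¹ = *-cancelʳ-< p 0<p
        (subst (q⁻¹ * p <_) (trans q⁻¹q≡1 (sym p⁻¹p≡1)) (*-monoʳ-< q⁻¹ 0<q⁻¹ p<q))
      split : L x q⁻¹ ⊎ U x p⁻¹ → Lⁱ p ⊎ Uⁱ q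
      split (inj₁ Lq⁻¹) = let (s , q⁻¹<s , Ls) = L-open x Lq⁻¹ in
        inj₂ (s , Ls , <-trans 0<q⁻¹ q⁻¹<s , subst₂ _<_ q⁻¹q≡1 (*-comm s q) (*-monoˡ-< q 0<q q⁻¹<s))
      split (inj₂ Up⁻¹) = let (r , r<p⁻¹ , Ur) = U-open x Up⁻¹ in
        inj₁ (r , Ur , subst₂ _<_ (*-comm r p) p⁻¹p≡1 (*-monoˡ-< p 0<p r<p⁻¹))

-- The non-negative square root; it is 0 on negative arguments.
√_ : ℝ → ℝ
√ x = record
  { L        = Lˢ
  ; U        = Uˢ
  ; L-inh    = - 1ℚ , inj₁ (negative⁻¹ (- 1ℚ))
  ; U-inh    = u-inh
  ; L-down   = l-down
  ; U-up     = λ { p<q (0<p , Up²) → <-trans 0<p p<q , U-up x (p²<q² (<⇒≤ 0<p) p<q) Up² }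
  ; L-open   = l-open
  ; U-open   = u-open
  ; disjoint = λ { (inj₁ q<0) (0<q , _) → <-asym q<0 0<q ; (inj₂ Lq²) (_ , Uq²) → disjoint x Lq² Uq² }
  ; located  = loc
  }
  where
  open +-*-Solver

  Lˢ Uˢ : ℚ → Set
  Lˢ q = q < 0ℚ ⊎ L x (q * q)
  Uˢ q = 0ℚ < q × U x (q * q)

  u-inh : ∃ Uˢ
  u-inh with U-inh x
  ... | b , Ub = q , <-≤-trans 0<1 1≤q , U-≤ x (≤-trans (p≤p⊔q b 1ℚ) q≤q²) Ub
    where
    q = b ⊔ 1ℚ
    1≤q : 1ℚ ≤ q
    1≤q = p≤q⊔p b 1ℚ
    q≤q² : q ≤ q * q
    q≤q² = subst (_≤ q * q) (*-identityʳ q) (*-monoʳ-≤ q (≤-trans (<⇒≤ 0<1) 1≤q) 1≤q)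

  l-down : ∀ {p q} → p < q → Lˢ q → Lˢ p
  l-down p<q (inj₁ q<0) = inj₁ (<-trans p<q q<0)
  l-down {p} p<q (inj₂ Lq²) with p <? 0ℚ
  ... | yes p<0 = inj₁ p<0
  ... | no  p≮0 = inj₂ (L-down x (p²<q² (≮⇒≥ p≮0) p<q) Lq²)

  l-open : ∀ {p} → Lˢ p → ∃[ q ] p < q × Lˢ q
  l-open (inj₁ p<0) = let (q , p<q , q<0) = <-dense p<0 in q , p<q , inj₁ q<0
  l-open {p} (inj₂ Lp²) with p <? 0ℚ
  ... | yes p<0 = let (q , p<q , q<0) = <-dense p<0 in q , p<q , inj₁ q<0
  ... | no  p≮0 with L-open x Lp²
  ...   | s , p²<s , Ls = p + t , p<p+q p 0<t , inj₂ (L-≤ x r²≤s Ls)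
    where
    0≤p : 0ℚ ≤ p
    0≤p = ≮⇒≥ p≮0
    D = s - p * p
    E = p + p + 1ℚ
    0<E : 0ℚ < E
    0<E = <-≤-trans 0<1 (subst (1ℚ ≤_) (+-comm 1ℚ (p + p)) (p≤p+q 1ℚ (≤-trans 0≤p (p≤p+q p 0≤p))))
    g : ℚ
    g = proj₁ (quotient D 0<E)
    gE≡D : g * E ≡ D
    gE≡D = proj₂ (quotient D 0<E)
    0<g : 0ℚ < g
    0<g = *-cancelʳ-< E 0<E (subst₂ _<_ (sym (*-zeroˡ E)) (sym gE≡D) (p<q⇒0<q-p p²<s))
    t = g ⊓ 1ℚ
    0<t : 0ℚ < t
    0<t = <-⊓ 0<g 0<1
    tF≤D : t * (p + p + t) ≤ D
    tF≤D = ≤-trans (*-monoʳ-≤ t (<⇒≤ 0<t) (+-monoʳ-≤ (p + p) (p⊓q≤q g 1ℚ)))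
                   (subst (t * E ≤_) gE≡D (*-monoˡ-≤ E (<⇒≤ 0<E) (p⊓q≤p g 1ℚ)))
    r²≤s : (p + t) * (p + t) ≤ s
    r²≤s = subst₂ _≤_
      (solve 2 (λ p t → p :* p :+ t :* (p :+ p :+ t) := (p :+ t) :* (p :+ t)) refl p t)
      (solve 2 (λ p s → p :* p :+ (s :- p :* p) := s) refl p s)
      (+-monoʳ-≤ (p * p) tF≤D)

  u-open : ∀ {q} → Uˢ q → ∃[ p ] p < q × Uˢ p
  u-open {q} (0<q , Uq²) with U-open x Uq²
  ... | s , s<q² , Us = r , r<q , 0<r , U-≤ x (≤-trans (p≤p⊔q s 0ℚ) s′≤r²) Us
    where
    s′ = s ⊔ 0ℚ
    s′<q² : s′ < q * q
    s′<q² = ⊔-< s<q² (*-pos 0<q 0<q)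
    w : ℚ
    w = proj₁ (quotient s′ 0<q)
    wq≡s′ : w * q ≡ s′
    wq≡s′ = proj₂ (quotient s′ 0<q)
    w<q : w < q
    w<q = *-cancelʳ-< q 0<q (subst (_< q * q) (sym wq≡s′) s′<q²)
    0≤w : 0ℚ ≤ w
    0≤w = *-cancelʳ-≤-pos q {{positive 0<q}} (subst₂ _≤_ (sym (*-zeroˡ q)) (sym wq≡s′) (p≤q⊔p s 0ℚ))
    r = ½ * (q + w)
    r<q : r < q
    r<q = subst (r <_) (solve 1 (λ q → con ½ :* (q :+ q) := q) refl q)
                (*-monoʳ-< ½ (positive⁻¹ ½) (+-monoʳ-< q w<q))
    0<r : 0ℚ < r
    0<r = *-pos (positive⁻¹ ½) (<-≤-trans 0<q (p≤p+q q 0≤w))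
    h = ½ * (q - w)
    s′≤r² : s′ ≤ r * r
    s′≤r² = subst₂ _≤_ wq≡s′
      (solve 2 (λ q w → w :* q :+ con ½ :* (q :- w) :* (con ½ :* (q :- w))
                     := con ½ :* (q :+ w) :* (con ½ :* (q :+ w))) refl q w)
      (p≤p+q (w * q) (p²≥0 h))

  loc : ∀ {p q} → p < q → Lˢ p ⊎ Uˢ q
  loc {p} {q} p<q with p <? 0ℚ
  ... | yes p<0 = inj₁ (inj₁ p<0)
  ... | no  p≮0 with located x (p²<q² (≮⇒≥ p≮0) p<q)
  ...   | inj₁ Lp² = inj₁ (inj₂ Lp²)
  ...   | inj₂ Uq² = inj₂ (≤-<-trans (≮⇒≥ p≮0) p<q , Uq²)

Colour : Set
Colour = Bool

-- The values on the diagonal are irrelevant: K n has no loops.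
record Colouring (n : ℕ) : Set where
  field
    colour    : Fin n → Fin n → Colour
    symmetric : ∀ i j → colour i j ≡ colour j i

open Colouring

edges : (n : ℕ) → List (Fin n × Fin n)
edges n = filter (λ (i , j) → i Fin.<? j) (cartesianProduct (allFin n) (allFin n))

edgeCount : ∀ {n} → Colouring n → Colour → ℕ
edgeCount {n} χ c = length (filter (λ (i , j) → colour χ i j Bool.≟ c) (edges n))

-- Every edge {i , j} has colour c exactly when R i j holds.
ColourClass : ∀ {n} → Colouring n → Colour → (Fin n → Fin n → Set) → Set
ColourClass χ c R = ∀ i j → i ≢ j → colour χ i j ≡ c ⇔ R i j

Within : ∀ {n} → Subset n → Fin n → Fin n → Set
Within A i j = i ∈ˢ A × j ∈ˢ A

-- A and ∁ A are the two k-sets: the vertex set has 2k elements and ∣ A ∣ ≡ k.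
𝓕 : ∀ k → Colouring (2 ℕ.* k) → Set
𝓕 k χ = ∃[ c ] Σ[ A ∈ Subset (2 ℕ.* k) ] ∣ A ∣ ≡ k ×
  (ColourClass χ c (Within A) ⊎ ColourClass χ c (λ i j → Within A i j ⊎ Within (∁ A) i j))

induced : ∀ {m n} → Colouring n → Fin m ↣ Fin n → Colouring m
induced χ f = record
  { colour    = λ i j → colour χ (to i) (to j)
  ; symmetric = λ i j → symmetric χ (to i) (to j)
  }
  where open Injection f using (to)

ContainsMember : ∀ k {n} → Colouring n → Set
ContainsMember k {n} χ = Σ[ f ∈ Fin (2 ℕ.* k) ↣ Fin n ] 𝓕 k (induced χ f)

Balanced : ∀ {n} → ℝ → Colouring n → Set
Balanced {n} ε χ = ∀ c → ε *ᴿ fromℕ (n C 2) ≤ᴿ fromℕ (edgeCount χ c)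

Unavoidable : ℕ → ℝ → ℕ → Set
Unavoidable k ε n₀ = ∀ n → n₀ ℕ.≤ n → (χ : Colouring n) → Balanced ε χ → ContainsMember k χ

-- n₀ is the number n(k,ε).
IsThreshold : ℕ → ℝ → ℕ → Set
IsThreshold k ε n₀ = Unavoidable k ε n₀ × (∀ m → Unavoidable k ε m → n₀ ℕ.≤ m)

{-# OPTIONS --safe #-}

-- Let n be about ε^(-(k-1)/2) and colour red a random set of about ε (n choose 2)
-- edges of K n. Every member of 𝓕 k contains a red K_k or a red K_{k,k}, and by a union
-- bound the expected number of those is below 1: C(n,k) ε^C(k,2) is of order 1/k!, and
-- C(n,k)² ε^(k²) is smaller still. For k = 2 a red K_2 is unavoidable, and a red star is used
-- instead; for n < 2k every balanced colouring will do.
module Submission where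

open import Defs using (ℝ; fromℚ; fromℕ; _<ᴿ_; _≤ᴿ_; _^ᴿ_; inverse; √_; IsThreshold)
open import Data.Nat using (ℕ; _∸_; _≤_)
open import Data.Rational using (0ℚ; ½)

open import Defs using (Colouring; edges; edgeCount; ContainsMember; induced; Within; ColourClass;
  _*ᴿ_; Unavoidable; Balanced; ratio; ratio-suc; ratio-bound)
open import Data.Bool using (Bool; true; false; if_then_else_; _∧_; _∨_; not)
import Data.Bool.Properties as Bool
open import Data.Empty using (⊥)
open import Data.Fin using (Fin; zero; suc)
import Data.Fin as Fin
import Data.Fin.Properties as Fin
open import Data.Fin.Subset using (Subset; inside; outside; ∁; ∣_∣) renaming (_∈_ to _∈ˢ_; ⊥ to ∅)
open import Data.Fin.Subset.Properties using (∣⊥∣≡0; ∣∁p∣≡n∸∣p∣; x∈p⇒x∉∁p; x∈∁p⇒x∉p)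
import Data.Integer as ℤ
open import Data.List using (List; []; _∷_; _++_; map; filter; length; cartesianProduct; allFin)
open import Data.List.Membership.Propositional using (_∈_)
open import Data.List.Membership.Propositional.Properties
  using (∈-filter⁺; ∈-filter⁻; ∈-map⁺; ∈-map⁻; ∈-++⁺ˡ; ∈-++⁺ʳ; ∈-++⁻; ∈-cartesianProduct⁺; ∈-cartesianProduct⁻)
open import Data.List.Properties using (map-tabulate; length-map; length-++; length-tabulate; length-filter)
import Data.List.Relation.Unary.All as All
open import Data.List.Relation.Unary.AllPairs using ([]; _∷_)
open import Data.List.Relation.Unary.Any using (here; there)
open import Data.List.Relation.Unary.Unique.Propositional using (Unique)
import Data.List.Relation.Unary.Unique.Propositional.Properties as Unique
open import Data.Nat
open import Data.Nat.Combinatorics using (_C_; nC1≡n; nCk+nC[k+1]≡[n+1]C[k+1]; k>n⇒nCk≡0)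
open import Data.Nat.ListAction using (sum)
open import Data.Nat.Properties
open import Data.Nat.Tactic.RingSolver using (solve-∀)
open import Data.Product using (Σ-syntax; ∃-syntax; _×_; _,_; proj₁; proj₂)
open import Data.Product.Properties using (≡-dec)
open import Data.Rational using (ℚ; 1ℚ)
import Data.Rational as ℚ
import Data.Rational.Properties as ℚ
open import Data.Rational.Solver using (module +-*-Solver)
open import Data.Sum using (_⊎_; inj₁; inj₂)
open import Data.Vec using ([]; _∷_; lookup; here; there; _[_]≔_)
open import Data.Vec.Properties using (lookup∘update′; lookup-replicate)
open import Function using (_∘_; id; Injective; Injection; Equivalence)
open import Relation.Binary using (tri<; tri≈; tri>)
open import Relation.Binary.Definitions using (DecidableEquality)
open import Relation.Binary.PropositionalEquality
open import Relation.Nullary using (¬_; Dec; does; yes; no; contradiction)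
open import Relation.Unary using (Decidable)

open Colouring

-- The number of red edges is fixed at M instead of being random, so that balance is automatic and
-- the union bound is the only estimate needed. Probabilities become counts of M-element sets of
-- edges, with every inequality cleared of denominators. What shapes the estimates is rounding, in
-- three places. The order n may exceed n₀ by up to 2. The inequality that gets refuted has n₀ - ½
-- in place of n₀, whence the odd number D = 2 n₀ - 1. And the red edges must reach ε N, where N =
-- C(n,2), so M is L + 1 (capped at N / 2) with L ≤ r N for a rational r > ε. The hypothesis
-- controls L / N but not M / N, and for sets of at least three edges the passage between them costs
-- a factor 9/4. The 1/k! hidden in C(n,k) pays for all of this: C(n,k) ≤ (3/8) (n₀ - ½)^k, so the
-- expected number of red cliques is at most 9/4 · 3/8 = 27/32. Bicliques add at most 81/2048, and
-- the total 1809/2048 is below 1.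

private variable
  A B : Set
  m n : ℕ

-- Counting in lists

bit : Bool → ℕ
bit true  = 1
bit false = 0

count : (A → Bool) → List A → ℕ
count p []       = 0
count p (x ∷ xs) = bit (p x) + count p xs

count-cong : {p q : A → Bool} (xs : List A) → (∀ {x} → x ∈ xs → p x ≡ q x) → count p xs ≡ count q xs
count-cong []       eq = refl
count-cong (x ∷ xs) eq = cong₂ _+_ (cong bit (eq (here refl))) (count-cong xs (eq ∘ there))

count-++ : (p : A → Bool) (xs ys : List A) → count p (xs ++ ys) ≡ count p xs + count p ys
count-++ p []       ys = refl
count-++ p (x ∷ xs) ys = trans (cong (bit (p x) +_) (count-++ p xs ys)) (sym (+-assoc (bit (p x)) _ _))

count-map : (p : B → Bool) (f : A → B) (xs : List A) → count p (map f xs) ≡ count (p ∘ f) xs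
count-map p f []       = refl
count-map p f (x ∷ xs) = cong (bit (p (f x)) +_) (count-map p f xs)

count-filter : (p : A → Bool) {P : A → Set} (P? : Decidable P) (xs : List A) →
               count p (filter P? xs) ≡ count (λ x → does (P? x) ∧ p x) xs
count-filter p P? []       = refl
count-filter p P? (x ∷ xs) with does (P? x)
... | true  = cong (bit (p x) +_) (count-filter p P? xs)
... | false = count-filter p P? xs

length-filter≡count : {P : A → Set} (P? : Decidable P) (xs : List A) →
                      length (filter P? xs) ≡ count (does ∘ P?) xs
length-filter≡count P? []       = refl
length-filter≡count P? (x ∷ xs) with does (P? x)
... | true  = cong suc (length-filter≡count P? xs)
... | false = length-filter≡count P? xs

count-true : (xs : List A) → count (λ _ → true) xs ≡ length xs
count-true []       = refl
count-true (x ∷ xs) = cong suc (count-true xs)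

count-not : (p : A → Bool) (xs : List A) → count p xs + count (not ∘ p) xs ≡ length xs
count-not p []       = refl
count-not p (x ∷ xs) with p x
... | true  = cong suc (count-not p xs)
... | false = trans (+-suc _ _) (cong suc (count-not p xs))

-- Sublists containing a given set, and conditional expectations

extend : Bool → (ℕ → ℕ) → ℕ → ℕ
extend true  f zero    = 0
extend true  f (suc M) = f M
extend false f zero    = f zero
extend false f (suc M) = f M + f (suc M)

-- The number of M-element sublists of xs that contain every element of xs satisfying S.
supersets : (A → Bool) → List A → ℕ → ℕ
supersets S []       zero    = 1
supersets S []       (suc M) = 0
supersets S (x ∷ xs) M       = extend (S x) (supersets S xs) M

supersets-< : (S : A → Bool) (xs : List A) {M : ℕ} → M < count S xs → supersets S xs M ≡ 0
supersets-< S (x ∷ xs) {zero} M<s with S x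
... | true  = refl
... | false = supersets-< S xs M<s
supersets-< S (x ∷ xs) {suc M} M<s with S x
... | true  = supersets-< S xs (s<s⁻¹ M<s)
... | false = cong₂ _+_ (supersets-< S xs (<-trans (n<1+n M) M<s)) (supersets-< S xs M<s)

count≤length : (p : A → Bool) (xs : List A) → count p xs ≤ length xs
count≤length p xs = subst (count p xs ≤_) (count-not p xs) (m≤m+n _ _)

nC0≡1 : ∀ n → n C 0 ≡ 1
nC0≡1 zero    = refl
nC0≡1 (suc n) = refl

supersets-+ : (S : A → Bool) (xs : List A) {s : ℕ} (j : ℕ) → count S xs ≡ s →
              supersets S xs (s + j) ≡ (length xs ∸ s) C j
supersets-+ S []       zero    refl = refl
supersets-+ S []       (suc j) refl = sym (k>n⇒nCk≡0 {0} {suc j} z<s)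
supersets-+ S (x ∷ xs) j refl with S x
... | true  = supersets-+ S xs j refl
... | false = trans (step j) (cong (_C j) (sym (+-∸-assoc 1 (count≤length S xs))))
  where
  open ≡-Reasoning
  s = count S xs
  f = supersets S xs
  step : ∀ j → extend false f (s + j) ≡ suc (length xs ∸ s) C j
  -- For j = 0 Pascal's rule does not apply. If s is positive, choosing x leaves s - 1 places for
  -- the s elements of S, so that summand vanishes.
  step zero with s in eq
  ... | zero  = supersets-+ S xs 0 eq
  ... | suc t = cong₂ _+_ (supersets-< S xs (subst (t + 0 <_) (sym eq) (s≤s (≤-reflexive (+-identityʳ t)))))
                          (supersets-+ S xs 0 eq)
  step (suc j) = begin
    extend false f (s + suc j)                      ≡⟨ cong (extend false f) (+-suc s j) ⟩
    f (s + j) + f (suc (s + j))                     ≡⟨ cong (λ t → f (s + j) + f t) (+-suc s j) ⟨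
    f (s + j) + f (s + suc j)                       ≡⟨ cong₂ _+_ (supersets-+ S xs j refl) (supersets-+ S xs (suc j) refl) ⟩
    (length xs ∸ s) C j + (length xs ∸ s) C suc j   ≡⟨ nCk+nC[k+1]≡[n+1]C[k+1] (length xs ∸ s) j ⟩
    suc (length xs ∸ s) C suc j                     ∎

-- With N the length of xs, this is C(N,M) times the expected number of members of 𝓑 that lie inside
-- a uniformly random M-element sublist.
weight : List (A → Bool) → List A → ℕ → ℕ
weight 𝓑 xs M = sum (map (λ S → supersets S xs M) 𝓑)

omitting : A → List (A → Bool) → List (A → Bool)
omitting x = filter (λ S → S x Bool.≟ false)

weight-zero : (𝓑 : List (A → Bool)) (x : A) (xs : List A) →
              weight 𝓑 (x ∷ xs) 0 ≡ weight (omitting x 𝓑) xs 0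
weight-zero []      x xs = refl
weight-zero (S ∷ 𝓑) x xs with S x
... | true  = weight-zero 𝓑 x xs
... | false = cong (supersets S xs 0 +_) (weight-zero 𝓑 x xs)

-- If x is chosen, every member of 𝓑 can still end up inside the sublist; if x is skipped, the
-- members containing x are disposed of. The split runs parallel to Pascal's rule for the number of
-- all sublists.
weight-suc : (𝓑 : List (A → Bool)) (x : A) (xs : List A) (M : ℕ) →
             weight 𝓑 (x ∷ xs) (suc M) ≡ weight 𝓑 xs M + weight (omitting x 𝓑) xs (suc M)
weight-suc []      x xs M = refl
weight-suc (S ∷ 𝓑) x xs M rewrite weight-suc 𝓑 x xs M with S x
... | true  = sym (+-assoc (supersets S xs M) _ _)
... | false = swap (supersets S xs M) _ _ _
  where
  swap : ∀ a b c d → (a + b) + (c + d) ≡ (a + c) + (b + d)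
  swap = solve-∀

Escapes : (red : A → Bool) → List A → (A → Bool) → Set
Escapes red xs S = ∃[ e ] e ∈ xs × S e ≡ true × red e ≡ false

m+n<o+p⇒m<o⊎n<p : ∀ {m n o p} → m + n < o + p → m < o ⊎ n < p
m+n<o+p⇒m<o⊎n<p {m} {n} {o} {p} lt with m <? o
... | yes m<o = inj₁ m<o
... | no  m≮o with n <? p
...   | yes n<p = inj₂ n<p
...   | no  n≮p = contradiction lt (≤⇒≯ (+-mono-≤ (≮⇒≥ m≮o) (≮⇒≥ n≮p)))

module _ {A : Set} (_≟_ : DecidableEquality A) where

  override : A → Bool → (A → Bool) → A → Bool
  override x b red y = if does (y ≟ x) then b else red y

  override-at : ∀ x b red → override x b red x ≡ b
  override-at x b red with x ≟ x
  ... | yes _  = refl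
  ... | no x≢x = contradiction refl x≢x

  override-∉ : ∀ {x} b red {xs} → All.All (x ≢_) xs → ∀ {y} → y ∈ xs → override x b red y ≡ red y
  override-∉ {x} b red x∉ {y} y∈ with y ≟ x
  ... | yes y≡x = contradiction (sym y≡x) (All.lookup x∉ y∈)
  ... | no  _   = refl

  count-override : ∀ {x} b red {xs} → All.All (x ≢_) xs →
                   count (override x b red) (x ∷ xs) ≡ bit b + count red xs
  count-override {x} b red x∉ = cong₂ _+_ (cong bit (override-at x b red)) (count-cong _ (override-∉ b red x∉))

  escapes-override : ∀ {x} b red {xs} {S : A → Bool} → All.All (x ≢_) xs →
                     Escapes red xs S → Escapes (override x b red) (x ∷ xs) S
  escapes-override b red x∉ (e , e∈ , Se , re) = e , there e∈ , Se , trans (override-∉ b red x∉ e∈) re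

  -- A member containing x escapes at x itself, which is not red, so only the members that omit x
  -- have to escape within xs.
  escapes-skipped : ∀ {x} red {xs 𝓑} → All.All (x ≢_) xs →
                    (∀ {S} → S ∈ omitting x 𝓑 → Escapes red xs S) →
                    ∀ {S} → S ∈ 𝓑 → Escapes (override x false red) (x ∷ xs) S
  escapes-skipped {x} red {𝓑 = 𝓑} x∉ esc {S} S∈ with S x in eq
  ... | true  = x , here refl , eq , override-at x false red
  ... | false = escapes-override false red x∉ (esc (∈-filter⁺ (λ S → S x Bool.≟ false) S∈ eq))

  -- The method of conditional expectations: 𝓑 has fewer expected members inside a
  -- uniformly random M-element sublist than 1, and each element of xs in turn can be
  -- decided without raising this expectation to 1.
  avoiding : ∀ {xs} → Unique xs → ∀ M (𝓑 : List (A → Bool)) → weight 𝓑 xs M < length xs C M →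
             Σ[ red ∈ (A → Bool) ] count red xs ≡ M × (∀ {S} → S ∈ 𝓑 → Escapes red xs S)
  -- With no elements left each surviving member weighs 1, so a weight below 1 means that none
  -- survives.
  avoiding []              zero    []      w< = (λ _ → false) , refl , λ ()
  avoiding []              zero    (S ∷ 𝓑) (s≤s ())
  avoiding {[]} []         (suc M) 𝓑       w< = contradiction (subst (weight 𝓑 [] (suc M) <_) (k>n⇒nCk≡0 {0} {suc M} z<s) w<) (λ ())
  avoiding {x ∷ xs} (x∉ ∷ u) zero  𝓑       w<
    with avoiding u zero (omitting x 𝓑) (subst₂ _<_ (weight-zero 𝓑 x xs) (sym (nC0≡1 (length xs))) w<)
  ... | red , card , esc = override x false red , trans (count-override false red x∉) card , escapes-skipped red x∉ esc
  avoiding {x ∷ xs} (x∉ ∷ u) (suc M) 𝓑     w<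
    -- Both sides are split by the choice at x, so the strict inequality persists in at least one
    -- half; that half dictates the choice.
    with m+n<o+p⇒m<o⊎n<p {weight 𝓑 xs M} {_} {length xs C M}
           (subst₂ _<_ (weight-suc 𝓑 x xs M) (sym (nCk+nC[k+1]≡[n+1]C[k+1] (length xs) M)) w<)
  ... | inj₁ lt with avoiding u M 𝓑 lt
  ...   | red , card , esc = override x true red , trans (count-override true red x∉) (cong suc card)
                           , λ S∈ → escapes-override true red x∉ (esc S∈)
  avoiding {x ∷ xs} (x∉ ∷ u) (suc M) 𝓑     w< | inj₂ lt with avoiding u (suc M) (omitting x 𝓑) lt
  ...   | red , card , esc = override x false red , trans (count-override false red x∉) card , escapes-skipped red x∉ esc

-- Densities of supersets

absorption : ∀ n k → suc k * (suc n C suc k) ≡ suc n * (n C k)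
absorption zero    zero    = refl
absorption zero    (suc k) = trans (cong (suc (suc k) *_) (k>n⇒nCk≡0 {1} {suc (suc k)} (s≤s (s≤s z≤n))))
                                   (trans (*-zeroʳ (suc (suc k))) (sym (trans (*-identityˡ (0 C suc k)) (k>n⇒nCk≡0 {0} {suc k} z<s))))
absorption (suc n) zero    = trans (*-identityˡ _) (trans (nC1≡n (suc (suc n))) (sym (trans (cong (suc (suc n) *_) (nC0≡1 (suc n))) (*-identityʳ _))))
absorption (suc n) (suc k) = begin
  suc (suc k) * (suc (suc n) C suc (suc k))                ≡⟨ cong (suc (suc k) *_) (nCk+nC[k+1]≡[n+1]C[k+1] (suc n) (suc k)) ⟨
  suc (suc k) * (X + suc n C suc (suc k))                  ≡⟨ *-distribˡ-+ (suc (suc k)) X _ ⟩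
  suc (suc k) * X + suc (suc k) * (suc n C suc (suc k))    ≡⟨ cong₂ _+_ (cong (X +_) (absorption n k)) (absorption n (suc k)) ⟩
  X + suc n * (n C k) + suc n * (n C suc k)                ≡⟨ regroup X (suc n) (n C k) (n C suc k) ⟩
  X + suc n * (n C k + n C suc k)                          ≡⟨ cong (λ t → X + suc n * t) (nCk+nC[k+1]≡[n+1]C[k+1] n k) ⟩
  suc (suc n) * X                                          ∎
  where
  open ≡-Reasoning
  X = suc n C suc k
  regroup : ∀ x n a b → x + n * a + n * b ≡ x + n * (a + b)
  regroup = solve-∀

nCk>0 : ∀ {n k} → k ≤ n → 0 < n C k
nCk>0 {n} z≤n = ≤-reflexive (sym (nC0≡1 n))
nCk>0 {suc n} (s≤s {k} k≤n) = <-≤-trans (nCk>0 k≤n) (subst (n C k ≤_) (nCk+nC[k+1]≡[n+1]C[k+1] n k) (m≤m+n _ _))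

-- By `absorption` the quotient of the two coefficients is (j + 1) / (a + 1), so it suffices to
-- compare this fraction with v / u.
C-ratio : ∀ a j u v → suc j * u ≤ v * suc a → (a C j) * u ≤ (suc a C suc j) * v
C-ratio a j u v le = *-cancelˡ-≤ (suc a) (begin
  suc a * ((a C j) * u)             ≡⟨ *-assoc (suc a) (a C j) u ⟨
  suc a * (a C j) * u               ≡⟨ cong (_* u) (absorption a j) ⟨
  suc j * Y * u                     ≡⟨ shuffle (suc j) Y u ⟩
  Y * (suc j * u)                   ≤⟨ *-monoʳ-≤ Y le ⟩
  Y * (v * suc a)                   ≡⟨ shuffle′ Y v (suc a) ⟩
  suc a * (Y * v)                   ∎)
  where
  open ≤-Reasoning
  Y = suc a C suc j
  shuffle : ∀ j y u → j * y * u ≡ y * (j * u)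
  shuffle = solve-∀
  shuffle′ : ∀ y v a → y * (v * a) ≡ a * (y * v)
  shuffle′ = solve-∀

module _ {N M′ : ℕ} (2M≤N : 2 * suc M′ ≤ N) (2≤M′ : 2 ≤ M′) where

  -- The density of the M-sets containing a given s-set is at most the square of M / N
  -- times (M′ / N) ^ (s - 2), and M ≤ 3 M′ / 2.
  subset-density : ∀ i a j → 2 + i + a ≡ N → 2 + i + j ≡ suc M′ →
                   4 * (a C j) * N ^ (2 + i) ≤ 9 * (N C suc M′) * M′ ^ (2 + i)
  subset-density zero a j refl refl = begin
    4 * X * (N * (N * 1))               ≡⟨ e₁ X N ⟩
    4 * (X * N) * N                     ≤⟨ *-monoˡ-≤ N (*-monoʳ-≤ 4 X≤) ⟩
    4 * (Y * (2 + j)) * N               ≡⟨ e₂ Y (2 + j) N ⟩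
    4 * (2 + j) * (N * Y)               ≡⟨ cong (4 * (2 + j) *_) (absorption (suc a) (suc j)) ⟨
    4 * (2 + j) * ((2 + j) * T)         ≡⟨ e₃ (2 + j) T ⟩
    T * ((2 * (2 + j)) * (2 * (2 + j))) ≤⟨ *-monoʳ-≤ T (*-mono-≤ 2j≤ 2j≤) ⟩
    T * ((3 * suc j) * (3 * suc j))     ≡⟨ e₄ (suc j) T ⟩
    9 * T * (suc j * (suc j * 1))       ∎
    where
    open ≤-Reasoning
    X = a C j
    Y = suc a C suc j
    T = suc (suc a) C suc (suc j)
    e₁ : ∀ x n → 4 * x * (n * (n * 1)) ≡ 4 * (x * n) * n
    e₁ = solve-∀
    e₂ : ∀ y j n → 4 * (y * j) * n ≡ 4 * j * (n * y)
    e₂ = solve-∀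
    e₃ : ∀ j t → 4 * j * (j * t) ≡ t * ((2 * j) * (2 * j))
    e₃ = solve-∀
    e₄ : ∀ j t → t * ((3 * j) * (3 * j)) ≡ 9 * t * (j * (j * 1))
    e₄ = solve-∀
    j≤a : j ≤ a
    j≤a = +-cancelˡ-≤ 2 j a (≤-trans (m≤m+n (2 + j) _) 2M≤N)
    -- The two factors are M / N and (M - 1) / (N - 1); the second is relaxed to M / N. Then M ≤ 3
    -- M′ / 2 is applied to both, which is the origin of 9/4.
    X≤ : X * N ≤ Y * (2 + j)
    X≤ = C-ratio a j (2 + a) (2 + j) (begin
      suc j * (2 + a)         ≡⟨ l j a ⟩
      2 + a + j * a + j + j   ≤⟨ +-monoʳ-≤ (2 + a + j * a + j) j≤a ⟩
      2 + a + j * a + j + a   ≡⟨ r j a ⟩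
      (2 + j) * suc a         ∎)
      where
      l : ∀ j a → suc j * (2 + a) ≡ 2 + a + j * a + j + j
      l = solve-∀
      r : ∀ j a → 2 + a + j * a + j + a ≡ (2 + j) * suc a
      r = solve-∀
    2j≤ : 2 * (2 + j) ≤ 3 * suc j
    2j≤ = begin
      2 * (2 + j)             ≡⟨ l j ⟩
      3 + 2 * j + 1           ≤⟨ +-monoʳ-≤ (3 + 2 * j) (s≤s⁻¹ 2≤M′) ⟩
      3 + 2 * j + j           ≡⟨ r j ⟩
      3 * suc j               ∎
      where
      l : ∀ j → 2 * (2 + j) ≡ 3 + 2 * j + 1
      l = solve-∀
      r : ∀ j → 3 + 2 * j + j ≡ 3 * suc j
      r = solve-∀
  subset-density (suc i) a j refl refl = begin
    4 * X * (N * N ^ (2 + i))           ≡⟨ e₁ X N (N ^ (2 + i)) ⟩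
    4 * (X * N) * N ^ (2 + i)           ≤⟨ *-monoˡ-≤ (N ^ (2 + i)) (*-monoʳ-≤ 4 X≤) ⟩
    4 * (Y * M′) * N ^ (2 + i)          ≡⟨ e₂ Y M′ (N ^ (2 + i)) ⟩
    M′ * (4 * Y * N ^ (2 + i))          ≤⟨ *-monoʳ-≤ M′ (subset-density i (suc a) (suc j) (+-suc (2 + i) a) (+-suc (2 + i) j)) ⟩
    M′ * (9 * T * M′ ^ (2 + i))         ≡⟨ e₃ M′ T (M′ ^ (2 + i)) ⟩
    9 * T * (M′ * M′ ^ (2 + i))         ∎
    where
    open ≤-Reasoning
    X = a C j
    Y = suc a C suc j
    T = N C suc M′
    e₁ : ∀ x n p → 4 * x * (n * p) ≡ 4 * (x * n) * p
    e₁ = solve-∀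
    e₂ : ∀ y m p → 4 * (y * m) * p ≡ m * (4 * y * p)
    e₂ = solve-∀
    e₃ : ∀ m t p → m * (9 * t * p) ≡ 9 * t * (m * p)
    e₃ = solve-∀
    2J≤A : 2 * suc j ≤ suc a
    2J≤A = +-cancelˡ-≤ (2 + i) (2 * suc j) (suc a) (begin
      2 + i + 2 * suc j               ≤⟨ m≤m+n _ (2 + i) ⟩
      2 + i + 2 * suc j + (2 + i)     ≡⟨ l i j ⟩
      2 * (3 + i + j)                 ≤⟨ 2M≤N ⟩
      3 + i + a                       ≡⟨ +-suc (2 + i) a ⟨
      2 + i + suc a                   ∎)
      where
      l : ∀ i j → 2 + i + 2 * suc j + (2 + i) ≡ 2 * (3 + i + j)
      l = solve-∀
    -- M′ / N is the mediant of (1 + j) / (1 + a), which is at most 1/2, and (1 + i) / (2 + i),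
    -- which is at least 1/2. Hence the new factor (1 + j) / (1 + a) is at most M′ / N.
    X≤ : X * (3 + i + a) ≤ Y * (2 + i + j)
    X≤ = C-ratio a j _ _ (begin
      suc j * (3 + i + a)                              ≡⟨ l i j a ⟩
      suc j * suc a + (2 + i) * suc j                  ≤⟨ +-monoʳ-≤ (suc j * suc a) (m≤m+n _ (i * suc j)) ⟩
      suc j * suc a + ((2 + i) * suc j + i * suc j)    ≡⟨ cong (suc j * suc a +_) (l′ i (suc j)) ⟩
      suc j * suc a + (1 + i) * (2 * suc j)            ≤⟨ +-monoʳ-≤ (suc j * suc a) (*-monoʳ-≤ (1 + i) 2J≤A) ⟩
      suc j * suc a + (1 + i) * suc a                  ≡⟨ r i j a ⟩
      (2 + i + j) * suc a                              ∎)
      where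
      l : ∀ i j a → suc j * (3 + i + a) ≡ suc j * suc a + (2 + i) * suc j
      l = solve-∀
      l′ : ∀ i j → (2 + i) * j + i * j ≡ (1 + i) * (2 * j)
      l′ = solve-∀
      r : ∀ i j a → suc j * suc a + (1 + i) * suc a ≡ (2 + i + j) * suc a
      r = solve-∀

-- If M = M′ + 1 is less than s there are no supersets at all; otherwise M ≥ s ≥ 3 supplies the M′ ≥
-- 2 on which the constant 9/4 rests.
supersets-bound : (S : A → Bool) (xs : List A) {s M′ : ℕ} → count S xs ≡ s → 3 ≤ s → 2 * suc M′ ≤ length xs →
                  4 * supersets S xs (suc M′) * length xs ^ s ≤ 9 * (length xs C suc M′) * M′ ^ s
supersets-bound S xs {suc zero} card (s≤s ())
supersets-bound S xs {suc (suc i)} {M′} card 3≤s 2M≤N with suc M′ <? 2 + i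
... | yes M<s rewrite supersets-< S xs (subst (suc M′ <_) (sym card) M<s) = z≤n
... | no  M≮s =
  subst (λ w → 4 * w * length xs ^ (2 + i) ≤ 9 * (length xs C suc M′) * M′ ^ (2 + i))
    (trans (sym (supersets-+ S xs j card)) (cong (supersets S xs) s+j≡M))
    (subset-density 2M≤N (s≤s⁻¹ (≤-trans 3≤s (≮⇒≥ M≮s))) i (length xs ∸ (2 + i)) j
      (m+[n∸m]≡n (subst (_≤ length xs) card (count≤length S xs))) s+j≡M)
  where
  j = suc M′ ∸ (2 + i)
  s+j≡M : 2 + i + j ≡ suc M′
  s+j≡M = m+[n∸m]≡n (≮⇒≥ M≮s)

-- The union bound and its constants

weight-bound : ∀ {u v} (𝓑 : List (A → Bool)) (xs : List A) (M : ℕ) →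
               (∀ {S} → S ∈ 𝓑 → supersets S xs M * u ≤ v) → weight 𝓑 xs M * u ≤ length 𝓑 * v
weight-bound         []      xs M le = z≤n
weight-bound {u = u} {v} (S ∷ 𝓑) xs M le =
  subst (_≤ v + length 𝓑 * v) (sym (*-distribʳ-+ u (supersets S xs M) (weight 𝓑 xs M)))
    (+-mono-≤ (le (here refl)) (weight-bound 𝓑 xs M (le ∘ there)))

weight-++ : (𝓑 𝓒 : List (A → Bool)) (xs : List A) (M : ℕ) →
            weight (𝓑 ++ 𝓒) xs M ≡ weight 𝓑 xs M + weight 𝓒 xs M
weight-++ []      𝓒 xs M = refl
weight-++ (S ∷ 𝓑) 𝓒 xs M = trans (cong (supersets S xs M +_) (weight-++ 𝓑 𝓒 xs M)) (sym (+-assoc (supersets S xs M) _ _))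

^-distribʳ-* : ∀ k m n → (m * n) ^ k ≡ m ^ k * n ^ k
^-distribʳ-* zero    m n = refl
^-distribʳ-* (suc k) m n = trans (cong (m * n *_) (^-distribʳ-* k m n)) (interchange m n (m ^ k) (n ^ k))
  where
  interchange : ∀ a b c d → a * b * (c * d) ≡ a * c * (b * d)
  interchange = solve-∀

power-of-square : ∀ x e k → (x ^ 2 * e) ^ k ≡ (x ^ k) ^ 2 * e ^ k
power-of-square x e k = trans (^-distribʳ-* k (x ^ 2) e)
  (cong (_* e ^ k) (trans (^-*-assoc x 2 k) (trans (cong (x ^_) (*-comm 2 k)) (sym (^-*-assoc x k 2)))))

square-cancel-≤ : ∀ {m n} → m ^ 2 ≤ n ^ 2 → m ≤ n
square-cancel-≤ {m} {n} le = ≮⇒≥ λ n<m → <⇒≱ (^-monoˡ-< 2 n<m) le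

-- Here D / 2 stands for n₀ - ½, s for C(k,2) and c for C(n,k). With ρ = L / N, `density` says (D /
-- 2)² ρ^(k-1) ≤ 1 and `few` says c ≤ (3/8) (D / 2)^k.
module _ {k s c D N L : ℕ} (2s≡ : 2 * s ≡ k * (k ∸ 1)) (3≤k : 3 ≤ k) (N>0 : 0 < N) (2L≤N : 2 * L ≤ N)
         (density : D ^ 2 * L ^ (k ∸ 1) ≤ 4 * N ^ (k ∸ 1))
         (few : 8 * (2 ^ k * c) ≤ 3 * D ^ k) where

  open ≤-Reasoning

  -- With ρ = L / N these say c ρ^s ≤ 3/8 and c² ρ^(k²) ≤ 9/512.
  expected-cliques : 8 * (c * L ^ s) ≤ 3 * N ^ s
  -- Squaring turns ρ^s into (ρ^(k-1))^k, to which the k-th power of `density` applies; the factor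
  -- (2 ^ k)² clears the denominator of (D / 2)^(2k).
  expected-cliques = square-cancel-≤ (*-cancelʳ-≤ _ _ ((2 ^ k) ^ 2) (begin
    (8 * (c * L ^ s)) ^ 2 * (2 ^ k) ^ 2          ≡⟨ e₁ (2 ^ k) c (L ^ s) ⟩
    (8 * (2 ^ k * c)) ^ 2 * (L ^ s) ^ 2          ≤⟨ *-monoˡ-≤ ((L ^ s) ^ 2) (^-monoˡ-≤ 2 few) ⟩
    (3 * D ^ k) ^ 2 * (L ^ s) ^ 2                ≡⟨ cong ((3 * D ^ k) ^ 2 *_) (doubled L) ⟩
    (3 * D ^ k) ^ 2 * (L ^ (k ∸ 1)) ^ k          ≡⟨ e₂ (D ^ k) ((L ^ (k ∸ 1)) ^ k) ⟩
    9 * ((D ^ k) ^ 2 * (L ^ (k ∸ 1)) ^ k)        ≡⟨ cong (9 *_) (power-of-square D (L ^ (k ∸ 1)) k) ⟨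
    9 * (D ^ 2 * L ^ (k ∸ 1)) ^ k                ≤⟨ *-monoʳ-≤ 9 (^-monoˡ-≤ k density) ⟩
    9 * (4 * N ^ (k ∸ 1)) ^ k                    ≡⟨ cong (9 *_) (power-of-square 2 (N ^ (k ∸ 1)) k) ⟩
    9 * ((2 ^ k) ^ 2 * (N ^ (k ∸ 1)) ^ k)        ≡⟨ cong (λ t → 9 * ((2 ^ k) ^ 2 * t)) (doubled N) ⟨
    9 * ((2 ^ k) ^ 2 * (N ^ s) ^ 2)              ≡⟨ e₃ (2 ^ k) (N ^ s) ⟩
    (3 * N ^ s) ^ 2 * (2 ^ k) ^ 2                ∎))
    where
    instance
      _ : NonZero ((2 ^ k) ^ 2)
      _ = m^n≢0 (2 ^ k) 2 {{m^n≢0 2 k}}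
    doubled : ∀ x → (x ^ s) ^ 2 ≡ (x ^ (k ∸ 1)) ^ k
    doubled x = trans (^-*-assoc x s 2) (trans (cong (x ^_) (trans (*-comm s 2) (trans 2s≡ (*-comm k (k ∸ 1)))))
                                               (sym (^-*-assoc x (k ∸ 1) k)))
    e₁ : ∀ t c l → 8 * (c * l) * (8 * (c * l) * 1) * (t * (t * 1)) ≡ 8 * (t * c) * (8 * (t * c) * 1) * (l * (l * 1))
    e₁ = solve-∀
    e₂ : ∀ d l → 3 * d * (3 * d * 1) * l ≡ 9 * (d * (d * 1) * l)
    e₂ = solve-∀
    e₃ : ∀ t n → 9 * (t * (t * 1) * (n * (n * 1))) ≡ 3 * n * (3 * n * 1) * (t * (t * 1))
    e₃ = solve-∀

  expected-bicliques : 512 * (c * c * L ^ (k * k)) ≤ 9 * N ^ (k * k)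
  expected-bicliques = begin
    512 * (c * c * L ^ (k * k))                       ≡⟨ cong (λ t → 512 * (c * c * t)) (split L) ⟩
    512 * (c * c * ((L ^ s) ^ 2 * L ^ k))             ≡⟨ e₁ c (L ^ s) (L ^ k) ⟩
    (8 * (c * L ^ s)) ^ 2 * (2 ^ 3 * L ^ k)           ≤⟨ *-mono-≤ (^-monoˡ-≤ 2 expected-cliques) 8Lᵏ≤Nᵏ ⟩
    (3 * N ^ s) ^ 2 * N ^ k                           ≡⟨ e₂ (N ^ s) (N ^ k) ⟩
    9 * ((N ^ s) ^ 2 * N ^ k)                         ≡⟨ cong (9 *_) (split N) ⟨
    9 * N ^ (k * k)                                   ∎
    where
    k² : k * k ≡ s * 2 + k
    k² = begin-equality
      k * k               ≡⟨ cong (k *_) (m∸n+n≡m (≤-trans (s≤s z≤n) 3≤k)) ⟨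
      k * (k ∸ 1 + 1)     ≡⟨ *-distribˡ-+ k (k ∸ 1) 1 ⟩
      k * (k ∸ 1) + k * 1 ≡⟨ cong₂ _+_ (trans (*-comm s 2) 2s≡) (sym (*-identityʳ k)) ⟨
      s * 2 + k           ∎
    split : ∀ x → x ^ (k * k) ≡ (x ^ s) ^ 2 * x ^ k
    split x = trans (cong (x ^_) k²) (trans (^-distribˡ-+-* x (s * 2) k) (cong (_* x ^ k) (sym (^-*-assoc x s 2))))
    -- Since k² = 2 s + k, a biclique has the factor ρ^k beyond the square of a clique's; ρ ≤ 1/2
    -- and k ≥ 3 make it at most 1/8.
    8Lᵏ≤Nᵏ : 2 ^ 3 * L ^ k ≤ N ^ k
    8Lᵏ≤Nᵏ = begin
      2 ^ 3 * L ^ k   ≤⟨ *-monoˡ-≤ (L ^ k) (^-monoʳ-≤ 2 3≤k) ⟩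
      2 ^ k * L ^ k   ≡⟨ ^-distribʳ-* k 2 L ⟨
      (2 * L) ^ k     ≤⟨ ^-monoˡ-≤ k 2L≤N ⟩
      N ^ k           ∎
    e₁ : ∀ c l m → 512 * (c * c * (l * (l * 1) * m)) ≡ 8 * (c * l) * (8 * (c * l) * 1) * (8 * m)
    e₁ = solve-∀
    e₂ : ∀ n m → 3 * n * (3 * n * 1) * m ≡ 9 * (n * (n * 1) * m)
    e₂ = solve-∀

  -- The factor 9/4 turns 3/8 and 9/512 into 27/32 and 81/2048, whose sum 1809/2048 is below 1.
  expected-total : ∀ {W₁ W₂ T} → 0 < T → W₁ * (4 * N ^ s) ≤ c * (9 * T * L ^ s) →
                   W₂ * (4 * N ^ (k * k)) ≤ c * c * (9 * T * L ^ (k * k)) → W₁ + W₂ < T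
  expected-total {W₁} {W₂} {T} T>0 le₁ le₂ = *-cancelˡ-< 2048 _ _ (begin-strict
    2048 * (W₁ + W₂)              ≡⟨ e₀ W₁ W₂ ⟩
    64 * (32 * W₁) + 2048 * W₂    ≤⟨ +-mono-≤ (*-monoʳ-≤ 64 cliques) bicliques ⟩
    64 * (27 * T) + 81 * T        ≡⟨ e₁ T ⟩
    1809 * T                      <⟨ *-monoˡ-< T {{>-nonZero T>0}} (≤ᵇ⇒≤ 1810 2048 _) ⟩
    2048 * T                      ∎)
    where
    e₀ : ∀ a b → 2048 * (a + b) ≡ 64 * (32 * a) + 2048 * b
    e₀ = solve-∀
    e₁ : ∀ t → 64 * (27 * t) + 81 * t ≡ 1809 * t
    e₁ = solve-∀
    cliques : 32 * W₁ ≤ 27 * T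
    cliques = *-cancelʳ-≤ _ _ (N ^ s) {{m^n≢0 N s {{>-nonZero N>0}}}} (begin
      32 * W₁ * N ^ s                ≡⟨ f₁ W₁ (N ^ s) ⟩
      8 * (W₁ * (4 * N ^ s))         ≤⟨ *-monoʳ-≤ 8 le₁ ⟩
      8 * (c * (9 * T * L ^ s))      ≡⟨ f₂ c T (L ^ s) ⟩
      9 * T * (8 * (c * L ^ s))      ≤⟨ *-monoʳ-≤ (9 * T) expected-cliques ⟩
      9 * T * (3 * N ^ s)            ≡⟨ f₃ T (N ^ s) ⟩
      27 * T * N ^ s                 ∎)
      where
      f₁ : ∀ w q → 32 * w * q ≡ 8 * (w * (4 * q))
      f₁ = solve-∀
      f₂ : ∀ c t p → 8 * (c * (9 * t * p)) ≡ 9 * t * (8 * (c * p))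
      f₂ = solve-∀
      f₃ : ∀ t q → 9 * t * (3 * q) ≡ 27 * t * q
      f₃ = solve-∀
    bicliques : 2048 * W₂ ≤ 81 * T
    bicliques = *-cancelʳ-≤ _ _ (N ^ (k * k)) {{m^n≢0 N (k * k) {{>-nonZero N>0}}}} (begin
      2048 * W₂ * N ^ (k * k)                 ≡⟨ f₁ W₂ (N ^ (k * k)) ⟩
      512 * (W₂ * (4 * N ^ (k * k)))          ≤⟨ *-monoʳ-≤ 512 le₂ ⟩
      512 * (c * c * (9 * T * L ^ (k * k)))   ≡⟨ f₂ (c * c) T (L ^ (k * k)) ⟩
      9 * T * (512 * (c * c * L ^ (k * k)))   ≤⟨ *-monoʳ-≤ (9 * T) expected-bicliques ⟩
      9 * T * (9 * N ^ (k * k))               ≡⟨ f₃ T (N ^ (k * k)) ⟩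
      81 * T * N ^ (k * k)                    ∎)
      where
      f₁ : ∀ w q → 2048 * w * q ≡ 512 * (w * (4 * q))
      f₁ = solve-∀
      f₂ : ∀ c t p → 512 * (c * (9 * t * p)) ≡ 9 * t * (512 * (c * p))
      f₂ = solve-∀
      f₃ : ∀ t q → 9 * t * (9 * q) ≡ 81 * t * q
      f₃ = solve-∀

-- Edges, cliques and bicliques

Edge : ℕ → Set
Edge n = Fin n × Fin n

allFin-suc : ∀ n → allFin (suc n) ≡ zero ∷ map suc (allFin n)
allFin-suc n = cong (zero ∷_) (sym (map-tabulate id suc))

-- The hypothesis on p removes the column of `zero`: in a pair i < j the vertex `zero` never comes
-- second.
count-product-suc : (p : Edge (suc n) → Bool) (xs ys : List (Fin n)) → (∀ i → p (suc i , zero) ≡ false) →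
                    count p (cartesianProduct (map suc xs) (zero ∷ map suc ys)) ≡
                    count (λ (i , j) → p (suc i , suc j)) (cartesianProduct xs ys)
count-product-suc p []       ys p0 = refl
count-product-suc p (x ∷ xs) ys p0 rewrite p0 x = begin
  count p (map (suc x ,_) (map suc ys) ++ cartesianProduct (map suc xs) (zero ∷ map suc ys))
    ≡⟨ count-++ p (map (suc x ,_) (map suc ys)) _ ⟩
  count p (map (suc x ,_) (map suc ys)) + count p (cartesianProduct (map suc xs) (zero ∷ map suc ys))
    ≡⟨ cong₂ _+_ (trans (count-map p (suc x ,_) (map suc ys)) (count-map _ suc ys)) (count-product-suc p xs ys p0) ⟩
  count (λ j → p (suc x , suc j)) ys + count q (cartesianProduct xs ys)
    ≡⟨ cong (_+ count q (cartesianProduct xs ys)) (count-map q (x ,_) ys) ⟨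
  count q (map (x ,_) ys) + count q (cartesianProduct xs ys)
    ≡⟨ count-++ q (map (x ,_) ys) (cartesianProduct xs ys) ⟨
  count q (map (x ,_) ys ++ cartesianProduct xs ys) ∎
  where
  open ≡-Reasoning
  q : Edge _ → Bool
  q (i , j) = p (suc i , suc j)

-- Splitting off the edges at the vertex `zero` opens every count over `edges` to induction along a
-- `Subset`.
count-edges-suc : (p : Edge (suc n) → Bool) →
                  count p (edges (suc n)) ≡
                  count (λ j → p (zero , suc j)) (allFin n) + count (λ (i , j) → p (suc i , suc j)) (edges n)
count-edges-suc {n} p = begin
  count p (edges (suc n))
    ≡⟨ count-filter p (λ (i , j) → i Fin.<? j) (cartesianProduct (allFin (suc n)) (allFin (suc n))) ⟩
  count P (cartesianProduct (allFin (suc n)) (allFin (suc n)))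
    ≡⟨ cong (λ xs → count P (cartesianProduct xs xs)) (allFin-suc n) ⟩
  count P (map (zero ,_) (map suc (allFin n)) ++ cartesianProduct (map suc (allFin n)) (zero ∷ map suc (allFin n)))
    ≡⟨ count-++ P (map (zero ,_) (map suc (allFin n))) _ ⟩
  count P (map (zero ,_) (map suc (allFin n))) + count P (cartesianProduct (map suc (allFin n)) (zero ∷ map suc (allFin n)))
    ≡⟨ cong₂ _+_ (trans (count-map P (zero ,_) (map suc (allFin n))) (count-map _ suc (allFin n)))
                 (count-product-suc P (allFin n) (allFin n) (λ _ → refl)) ⟩
  count (λ j → p (zero , suc j)) (allFin n) + count (λ (i , j) → P (suc i , suc j)) (cartesianProduct (allFin n) (allFin n))
    ≡⟨ cong (count (λ j → p (zero , suc j)) (allFin n) +_)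
         (count-filter (λ (i , j) → p (suc i , suc j)) (λ (i , j) → i Fin.<? j) (cartesianProduct (allFin n) (allFin n))) ⟨
  count (λ j → p (zero , suc j)) (allFin n) + count (λ (i , j) → p (suc i , suc j)) (edges n) ∎
  where
  open ≡-Reasoning
  P : Edge (suc n) → Bool
  P (i , j) = does (i Fin.<? j) ∧ p (i , j)

count-false : (xs : List A) → count (λ _ → false) xs ≡ 0
count-false []       = refl
count-false (x ∷ xs) = count-false xs

count-lookup : (A : Subset n) → count (lookup A) (allFin n) ≡ ∣ A ∣
count-lookup [] = refl
count-lookup {suc n} (b ∷ A) rewrite sym (map-tabulate {n = n} id Fin.suc) | count-map (lookup (b ∷ A)) suc (allFin n) | count-lookup A
  with b
... | true  = refl
... | false = refl

[1+n]C2 : ∀ n → suc n C 2 ≡ n + n C 2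
[1+n]C2 n = trans (sym (nCk+nC[k+1]≡[n+1]C[k+1] n 1)) (cong (_+ n C 2) (nC1≡n n))

clique : Subset n → Edge n → Bool
clique A (i , j) = lookup A i ∧ lookup A j

biclique : Subset n → Subset n → Edge n → Bool
biclique A B (i , j) = (lookup A i ∧ lookup B j) ∨ (lookup B i ∧ lookup A j)

Disjoint : Subset n → Subset n → Set
Disjoint A B = ∀ i → lookup A i ∧ lookup B i ≡ false

count-clique : (A : Subset n) → count (clique A) (edges n) ≡ ∣ A ∣ C 2
count-clique []          = refl
count-clique {suc n} (outside ∷ A) = trans (count-edges-suc (clique (outside ∷ A)))
  (cong₂ _+_ (count-false (allFin n)) (count-clique A))
count-clique (inside  ∷ A) = trans (count-edges-suc (clique (inside ∷ A)))
  (trans (cong₂ _+_ (count-lookup A) (count-clique A)) (sym ([1+n]C2 ∣ A ∣)))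

count-biclique : (A B : Subset n) → Disjoint A B → count (biclique A B) (edges n) ≡ ∣ A ∣ * ∣ B ∣
count-biclique []            []            dis = refl
count-biclique (inside  ∷ A) (inside  ∷ B) dis with () ← dis zero
count-biclique {suc n} (inside  ∷ A) (outside ∷ B) dis = trans (count-edges-suc (biclique (inside ∷ A) (outside ∷ B)))
  (cong₂ _+_ (trans (count-cong (allFin n) (λ {j} _ → Bool.∨-identityʳ (lookup B j))) (count-lookup B))
             (count-biclique A B (dis ∘ suc)))
count-biclique (outside ∷ A) (inside  ∷ B) dis = trans (count-edges-suc (biclique (outside ∷ A) (inside ∷ B)))
  (trans (cong₂ _+_ (count-lookup A) (count-biclique A B (dis ∘ suc))) (sym (*-suc ∣ A ∣ ∣ B ∣)))
count-biclique {suc n} (outside ∷ A) (outside ∷ B) dis = trans (count-edges-suc (biclique (outside ∷ A) (outside ∷ B)))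
  (cong₂ _+_ (count-false (allFin n)) (count-biclique A B (dis ∘ suc)))

length-edges : ∀ n → length (edges n) ≡ n C 2
length-edges zero    = refl
length-edges (suc n) = begin
  length (edges (suc n))                                        ≡⟨ count-true (edges (suc n)) ⟨
  count (λ _ → true) (edges (suc n))                            ≡⟨ count-edges-suc {n} (λ _ → true) ⟩
  count (λ _ → true) (allFin n) + count (λ _ → true) (edges n)  ≡⟨ cong₂ _+_ (count-true (allFin n)) (count-true (edges n)) ⟩
  length (allFin n) + length (edges n)                          ≡⟨ cong₂ _+_ (length-tabulate id) (length-edges n) ⟩
  n + n C 2                                                     ≡⟨ [1+n]C2 n ⟨
  suc n C 2                                                     ∎
  where open ≡-Reasoning

-- Vertex sets of given size and their images

subsetsOfSize : (n k : ℕ) → List (Subset n)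
subsetsOfSize zero    zero    = [] ∷ []
subsetsOfSize zero    (suc k) = []
subsetsOfSize (suc n) zero    = map (outside ∷_) (subsetsOfSize n zero)
subsetsOfSize (suc n) (suc k) = map (inside ∷_) (subsetsOfSize n k) ++ map (outside ∷_) (subsetsOfSize n (suc k))

length-subsetsOfSize : (n k : ℕ) → length (subsetsOfSize n k) ≡ n C k
length-subsetsOfSize zero    zero    = refl
length-subsetsOfSize zero    (suc k) = sym (k>n⇒nCk≡0 {0} {suc k} z<s)
length-subsetsOfSize (suc n) zero    = trans (length-map _ (subsetsOfSize n zero)) (trans (length-subsetsOfSize n zero) (nC0≡1 n))
length-subsetsOfSize (suc n) (suc k) =
  trans (length-++ (map (inside ∷_) (subsetsOfSize n k)))
  (trans (cong₂ _+_ (trans (length-map _ (subsetsOfSize n k)) (length-subsetsOfSize n k))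
                    (trans (length-map _ (subsetsOfSize n (suc k))) (length-subsetsOfSize n (suc k))))
         (nCk+nC[k+1]≡[n+1]C[k+1] n k))

∈-subsetsOfSize⁺ : ∀ {k} (A : Subset n) → ∣ A ∣ ≡ k → A ∈ subsetsOfSize n k
∈-subsetsOfSize⁺ []            refl = here refl
∈-subsetsOfSize⁺ (inside  ∷ A) refl = ∈-++⁺ˡ (∈-map⁺ (inside ∷_) (∈-subsetsOfSize⁺ A refl))
∈-subsetsOfSize⁺ {k = zero}  (outside ∷ A) eq = ∈-map⁺ (outside ∷_) (∈-subsetsOfSize⁺ A eq)
∈-subsetsOfSize⁺ {k = suc k} (outside ∷ A) eq = ∈-++⁺ʳ (map (inside ∷_) (subsetsOfSize _ k)) (∈-map⁺ (outside ∷_) (∈-subsetsOfSize⁺ A eq))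

∈-subsetsOfSize⁻ : ∀ n k {A : Subset n} → A ∈ subsetsOfSize n k → ∣ A ∣ ≡ k
∈-subsetsOfSize⁻ zero    zero    (here refl) = refl
∈-subsetsOfSize⁻ (suc n) zero    A∈ with ∈-map⁻ (outside ∷_) A∈
... | A′ , A′∈ , refl = ∈-subsetsOfSize⁻ n zero A′∈
∈-subsetsOfSize⁻ (suc n) (suc k) A∈ with ∈-++⁻ (map (inside ∷_) (subsetsOfSize n k)) A∈
... | inj₁ l with ∈-map⁻ (inside ∷_) l
...   | A′ , A′∈ , refl = cong suc (∈-subsetsOfSize⁻ n k A′∈)
∈-subsetsOfSize⁻ (suc n) (suc k) A∈ | inj₂ r with ∈-map⁻ (outside ∷_) r
...   | A′ , A′∈ , refl = ∈-subsetsOfSize⁻ n (suc k) A′∈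

image : (Fin m → Fin n) → Subset m → Subset n
image f []            = ∅
image f (inside  ∷ A) = image (f ∘ suc) A [ f zero ]≔ inside
image f (outside ∷ A) = image (f ∘ suc) A

∈-image⁻ : (f : Fin m → Fin n) (A : Subset m) {v : Fin n} → lookup (image f A) v ≡ true →
           ∃[ i ] i ∈ˢ A × f i ≡ v
∈-image⁻ f []            {v} v∈ with () ← trans (sym v∈) (lookup-replicate v outside)
∈-image⁻ f (outside ∷ A) v∈ with ∈-image⁻ (f ∘ suc) A v∈
... | i , i∈ , fi≡v = suc i , there i∈ , fi≡v
∈-image⁻ f (inside ∷ A) {v} v∈ with f zero Fin.≟ v
... | yes f0≡v = zero , here , f0≡v
... | no  f0≢v with ∈-image⁻ (f ∘ suc) A (trans (sym (lookup∘update′ (f0≢v ∘ sym) (image (f ∘ suc) A) inside)) v∈)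
...   | i , i∈ , fi≡v = suc i , there i∈ , fi≡v

∣p[x]≔inside∣ : (p : Subset n) (x : Fin n) → lookup p x ≡ false → ∣ p [ x ]≔ inside ∣ ≡ suc ∣ p ∣
∣p[x]≔inside∣ (outside ∷ p) zero    eq = refl
∣p[x]≔inside∣ (inside  ∷ p) (suc x) eq = cong suc (∣p[x]≔inside∣ p x eq)
∣p[x]≔inside∣ (outside ∷ p) (suc x) eq = ∣p[x]≔inside∣ p x eq

∣image∣ : (f : Fin m → Fin n) → Injective _≡_ _≡_ f → (A : Subset m) → ∣ image f A ∣ ≡ ∣ A ∣
∣image∣ {n = n} f inj []            = ∣⊥∣≡0 n
∣image∣         f inj (outside ∷ A) = ∣image∣ (f ∘ suc) (Fin.suc-injective ∘ inj) A
∣image∣         f inj (inside  ∷ A) =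
  trans (∣p[x]≔inside∣ (image (f ∘ suc) A) (f zero) f0∉) (cong suc (∣image∣ (f ∘ suc) (Fin.suc-injective ∘ inj) A))
  where
  f0∉ : lookup (image (f ∘ suc) A) (f zero) ≡ false
  f0∉ with lookup (image (f ∘ suc) A) (f zero) in eq
  ... | false = refl
  ... | true with ∈-image⁻ (f ∘ suc) A eq
  ...   | i , _ , fi≡f0 with () ← inj fi≡f0

disjoint-images : (f : Fin m → Fin n) → Injective _≡_ _≡_ f → (A : Subset m) → Disjoint (image f A) (image f (∁ A))
disjoint-images f inj A v with lookup (image f A) v in eq | lookup (image f (∁ A)) v in eq′
... | false | _     = refl
... | true  | false = refl
... | true  | true with ∈-image⁻ f A eq | ∈-image⁻ f (∁ A) eq′
...   | i , i∈ , fi≡v | j , j∈ , fj≡v with inj (trans fi≡v (sym fj≡v))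
...     | refl = contradiction j∈ (x∈p⇒x∉∁p i∈)

-- Colourings given by their red edges

fromRed : (Edge n → Bool) → Colouring n
fromRed {n} red = record { colour = col ; symmetric = col-sym }
  where
  col : Fin n → Fin n → Bool
  col i j with Fin.<-cmp i j
  ... | tri< _ _ _ = red (i , j)
  ... | tri≈ _ _ _ = false
  ... | tri> _ _ _ = red (j , i)
  col-sym : ∀ i j → col i j ≡ col j i
  col-sym i j with Fin.<-cmp i j | Fin.<-cmp j i
  ... | tri< _ _ _     | tri> _ _ _     = refl
  ... | tri≈ _ _ _     | tri≈ _ _ _     = refl
  ... | tri> _ _ _     | tri< _ _ _     = refl
  ... | tri< i<j _ _   | tri< _ _ j≯i   = contradiction i<j j≯i
  ... | tri< _ i≢j _   | tri≈ _ j≡i _   = contradiction (sym j≡i) i≢j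
  ... | tri≈ _ i≡j _   | tri< _ j≢i _   = contradiction (sym i≡j) j≢i
  ... | tri≈ _ i≡j _   | tri> _ j≢i _   = contradiction (sym i≡j) j≢i
  ... | tri> _ i≢j _   | tri≈ _ j≡i _   = contradiction (sym j≡i) i≢j
  ... | tri> _ _ i>j   | tri> j≮i _ _   = contradiction i>j j≮i

fromRed-< : (red : Edge n → Bool) {i j : Fin n} → i Fin.< j → colour (fromRed red) i j ≡ red (i , j)
fromRed-< red {i} {j} i<j with Fin.<-cmp i j
... | tri< _ _ _   = refl
... | tri≈ i≮j _ _ = contradiction i<j i≮j
... | tri> i≮j _ _ = contradiction i<j i≮j

∈-edges⇒< : {e : Edge n} → e ∈ edges n → proj₁ e Fin.< proj₂ e
∈-edges⇒< {n} e∈ = proj₂ (∈-filter⁻ (λ (i , j) → i Fin.<? j) {xs = cartesianProduct (allFin n) (allFin n)} e∈)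

edgeCount-fromRed : (red : Edge n → Bool) →
                    edgeCount (fromRed red) true ≡ count red (edges n) ×
                    edgeCount (fromRed red) false ≡ count (not ∘ red) (edges n)
edgeCount-fromRed {n} red =
    trans (length-filter≡count (λ (i , j) → colour (fromRed red) i j Bool.≟ true) (edges n))
          (count-cong (edges n) (λ e∈ → trans (is-true _) (fromRed-< red (∈-edges⇒< e∈))))
  , trans (length-filter≡count (λ (i , j) → colour (fromRed red) i j Bool.≟ false) (edges n))
          (count-cong (edges n) (λ e∈ → trans (is-false _) (cong not (fromRed-< red (∈-edges⇒< e∈)))))
  where
  is-true : ∀ b → does (b Bool.≟ true) ≡ b
  is-true true  = refl
  is-true false = refl
  is-false : ∀ b → does (b Bool.≟ false) ≡ not b
  is-false true  = refl
  is-false false = refl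

module _ {k : ℕ} (red : Edge n → Bool)
         (no-clique   : ∀ A → ∣ A ∣ ≡ k → Escapes red (edges n) (clique A))
         (no-biclique : ∀ A B → ∣ A ∣ ≡ k → ∣ B ∣ ≡ k → Disjoint A B → Escapes red (edges n) (biclique A B)) where

  -- The colour `true` is red. If red forms the cliques, A is a red clique. If blue forms a single
  -- clique on A, then ∁ A is a red clique. If blue forms both cliques, all edges between A and ∁ A
  -- are red.
  no-member : ¬ ContainsMember k (fromRed red)
  no-member (f , c , A , ∣A∣≡k , classes) = cases c classes
    where
    open Injection f using (to; injective)
    χ = fromRed red
    χᶠ = induced χ f
    ∣∁A∣≡k : ∣ ∁ A ∣ ≡ k
    ∣∁A∣≡k = trans (∣∁p∣≡n∸∣p∣ A) (trans (cong₂ _∸_ (cong (k +_) (+-identityʳ k)) ∣A∣≡k) (m+n∸n≡m k k))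

    not-red : ∀ {e} → e ∈ edges n → red e ≡ false → ∀ i j → to i ≡ proj₁ e → to j ≡ proj₂ e →
              (i ≢ j → colour χᶠ i j ≡ true) → ⊥
    not-red e∈ white i j refl refl redᵢⱼ with () ←
      trans (sym (redᵢⱼ (λ { refl → Fin.<-irrefl refl (∈-edges⇒< e∈) }))) (trans (fromRed-< red (∈-edges⇒< e∈)) white)

    red-clique : (B : Subset (2 * k)) → ∣ B ∣ ≡ k →
                 ¬ (∀ i j → i ∈ˢ B → j ∈ˢ B → i ≢ j → colour χᶠ i j ≡ true)
    red-clique B ∣B∣≡k all-red with no-clique (image to B) (trans (∣image∣ to injective B) ∣B∣≡k)
    ... | (u , v) , e∈ , inS , white
      with ∈-image⁻ to B (Bool.∧-conicalˡ _ _ inS) | ∈-image⁻ to B (Bool.∧-conicalʳ (lookup (image to B) u) _ inS)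
    ...   | i , i∈ , refl | j , j∈ , refl = not-red e∈ white i j refl refl (all-red i j i∈ j∈)

    red-biclique : ¬ (∀ i j → i ∈ˢ A → j ∈ˢ ∁ A → i ≢ j → colour χᶠ i j ≡ true)
    red-biclique all-red with no-biclique (image to A) (image to (∁ A))
      (trans (∣image∣ to injective A) ∣A∣≡k) (trans (∣image∣ to injective (∁ A)) ∣∁A∣≡k) (disjoint-images to injective A)
    ... | (u , v) , e∈ , inS , white with lookup (image to A) u ∧ lookup (image to (∁ A)) v in eq
    ...   | true with ∈-image⁻ to A (Bool.∧-conicalˡ _ _ eq) | ∈-image⁻ to (∁ A) (Bool.∧-conicalʳ (lookup (image to A) u) _ eq)
    ...     | i , i∈ , refl | j , j∈ , refl = not-red e∈ white i j refl refl (all-red i j i∈ j∈)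
    -- An edge lists its smaller endpoint first, so the endpoint from the image of A may come
    -- second; symmetry of the colouring handles this.
    red-biclique all-red | (u , v) , e∈ , inS , white | false
      with ∈-image⁻ to (∁ A) (Bool.∧-conicalˡ _ _ inS) | ∈-image⁻ to A (Bool.∧-conicalʳ (lookup (image to (∁ A)) u) _ inS)
    ...     | j , j∈ , refl | i , i∈ , refl = not-red e∈ white j i refl refl
              (λ j≢i → trans (symmetric χᶠ j i) (all-red i j i∈ j∈ (j≢i ∘ sym)))

    cases : ∀ c → ColourClass χᶠ c (Within A) ⊎ ColourClass χᶠ c (λ i j → Within A i j ⊎ Within (∁ A) i j) → ⊥
    cases true  (inj₁ cl) = red-clique A ∣A∣≡k (λ i j i∈ j∈ i≢j → Equivalence.from (cl i j i≢j) (i∈ , j∈))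
    cases true  (inj₂ cl) = red-clique A ∣A∣≡k (λ i j i∈ j∈ i≢j → Equivalence.from (cl i j i≢j) (inj₁ (i∈ , j∈)))
    cases false (inj₁ cl) = red-clique (∁ A) ∣∁A∣≡k (λ i j i∈ j∈ i≢j →
      Bool.¬-not (λ blue → x∈∁p⇒x∉p i∈ (proj₁ (Equivalence.to (cl i j i≢j) blue))))
    cases false (inj₂ cl) = red-biclique (λ i j i∈ j∈ i≢j → Bool.¬-not (λ blue → across i∈ j∈ (Equivalence.to (cl i j i≢j) blue)))
      where
      across : ∀ {i j} → i ∈ˢ A → j ∈ˢ ∁ A → Within A i j ⊎ Within (∁ A) i j → ⊥
      across i∈ j∈ (inj₁ (_ , j∈A))  = x∈∁p⇒x∉p j∈ j∈A
      across i∈ j∈ (inj₂ (i∈∁A , _)) = x∈∁p⇒x∉p i∈∁A i∈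

-- Colourings without a member of 𝓕 k

2*[1+n]C2 : ∀ n → 2 * (suc n C 2) ≡ suc n * n
2*[1+n]C2 n = trans (absorption n 1) (cong (suc n *_) (nC1≡n n))

-- The quotient C(n,k+1) / C(n,k) is at most n / (k + 1). With e = D this drives the induction of
-- `C-bound`, where each step in k gains a factor D / 2 on the right.
C-step : ∀ n k e → 2 * n ≤ suc k * e → 2 * (n C suc k) ≤ e * (n C k)
C-step zero    k e le rewrite k>n⇒nCk≡0 {0} {suc k} z<s = z≤n
C-step (suc n) k e le = *-cancelˡ-≤ (suc k) (begin
  suc k * (2 * (suc n C suc k))     ≡⟨ e₁ (suc k) (suc n C suc k) ⟩
  2 * (suc k * (suc n C suc k))     ≡⟨ cong (2 *_) (absorption n k) ⟩
  2 * (suc n * (n C k))             ≡⟨ *-assoc 2 (suc n) (n C k) ⟨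
  2 * suc n * (n C k)               ≤⟨ *-mono-≤ le (C-monoˡ n k) ⟩
  suc k * e * (suc n C k)           ≡⟨ *-assoc (suc k) e (suc n C k) ⟩
  suc k * (e * (suc n C k))         ∎)
  where
  open ≤-Reasoning
  e₁ : ∀ k x → k * (2 * x) ≡ 2 * (k * x)
  e₁ = solve-∀
  C-monoˡ : ∀ n k → n C k ≤ suc n C k
  C-monoˡ n zero    = ≤-reflexive (trans (nC0≡1 n) (sym (nC0≡1 (suc n))))
  C-monoˡ n (suc k) = subst (n C suc k ≤_) (nCk+nC[k+1]≡[n+1]C[k+1] n k) (m≤n+m _ _)

6*[3+a]C3 : ∀ a → 6 * ((3 + a) C 3) ≡ (3 + a) * ((2 + a) * (1 + a))
6*[3+a]C3 a = begin
  6 * ((3 + a) C 3)              ≡⟨ *-assoc 2 3 ((3 + a) C 3) ⟩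
  2 * (3 * ((3 + a) C 3))        ≡⟨ cong (2 *_) (absorption (2 + a) 2) ⟩
  2 * ((3 + a) * ((2 + a) C 2))  ≡⟨ e₁ (3 + a) ((2 + a) C 2) ⟩
  (3 + a) * (2 * ((2 + a) C 2))  ≡⟨ cong ((3 + a) *_) (2*[1+n]C2 (1 + a)) ⟩
  (3 + a) * ((2 + a) * (1 + a))  ∎
  where
  open ≡-Reasoning
  e₁ : ∀ x y → 2 * (x * y) ≡ x * (2 * y)
  e₁ = solve-∀

-- C(n,k) ≤ (3/8) (n₀ - ½)^k for 6 ≤ n ≤ n₀ + 2, with n = 3 + a, k = 3 + i and n₀ = 6 + t, cleared
-- of denominators by D = 2 n₀ - 1. The case k = 3 is tight enough to force n₀ ≥ 6.
C-bound : ∀ t a i → a ≤ 5 + t → 8 * (2 ^ (3 + i) * ((3 + a) C (3 + i))) ≤ 3 * suc (2 * (5 + t)) ^ (3 + i)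
C-bound t a zero    a≤ = *-cancelˡ-≤ 3 (begin
  3 * (8 * (8 * ((3 + a) C 3)))                       ≡⟨ e₁ ((3 + a) C 3) ⟩
  32 * (6 * ((3 + a) C 3))                            ≡⟨ cong (32 *_) (6*[3+a]C3 a) ⟩
  32 * ((3 + a) * ((2 + a) * (1 + a)))                ≤⟨ *-monoʳ-≤ 32 (*-mono-≤ (+-monoʳ-≤ 3 a≤) (*-mono-≤ (+-monoʳ-≤ 2 a≤) (+-monoʳ-≤ 1 a≤))) ⟩
  32 * ((8 + t) * ((7 + t) * (6 + t)))                ≤⟨ m≤m+n _ _ ⟩
  -- The added polynomial is the difference 9 D³ - 32 (8 + t) (7 + t) (6 + t) with D = 11 + 2 t; all
  -- its coefficients are positive.
  32 * ((8 + t) * ((7 + t) * (6 + t))) + (1227 + 1862 * t + 516 * (t * t) + 40 * (t * (t * t)))  ≡⟨ e₂ t ⟩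
  3 * (3 * (suc (2 * (5 + t)) * (suc (2 * (5 + t)) * (suc (2 * (5 + t)) * 1))))                  ∎)
  where
  open ≤-Reasoning
  e₁ : ∀ x → 3 * (8 * (8 * x)) ≡ 32 * (6 * x)
  e₁ = solve-∀
  e₂ : ∀ t → 32 * ((8 + t) * ((7 + t) * (6 + t))) + (1227 + 1862 * t + 516 * (t * t) + 40 * (t * (t * t))) ≡
             3 * (3 * (suc (2 * (5 + t)) * (suc (2 * (5 + t)) * (suc (2 * (5 + t)) * 1))))
  e₂ = solve-∀
C-bound t a (suc i) a≤ = begin
  8 * (2 * 2 ^ (3 + i) * ((3 + a) C (4 + i)))     ≡⟨ e₁ (2 ^ (3 + i)) ((3 + a) C (4 + i)) ⟩
  8 * (2 ^ (3 + i) * (2 * ((3 + a) C (4 + i))))   ≤⟨ *-monoʳ-≤ 8 (*-monoʳ-≤ (2 ^ (3 + i)) (C-step (3 + a) (3 + i) D 2n≤)) ⟩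
  8 * (2 ^ (3 + i) * (D * ((3 + a) C (3 + i))))   ≡⟨ e₂ D (2 ^ (3 + i)) ((3 + a) C (3 + i)) ⟩
  D * (8 * (2 ^ (3 + i) * ((3 + a) C (3 + i))))   ≤⟨ *-monoʳ-≤ D (C-bound t a i a≤) ⟩
  D * (3 * D ^ (3 + i))                           ≡⟨ e₃ D (D ^ (3 + i)) ⟩
  3 * (D * D ^ (3 + i))                           ∎
  where
  open ≤-Reasoning
  D = suc (2 * (5 + t))
  e₁ : ∀ p x → 8 * (2 * p * x) ≡ 8 * (p * (2 * x))
  e₁ = solve-∀
  e₂ : ∀ d p x → 8 * (p * (d * x)) ≡ d * (8 * (p * x))
  e₂ = solve-∀
  e₃ : ∀ d p → d * (3 * p) ≡ 3 * (d * p)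
  e₃ = solve-∀
  2n≤ : 2 * (3 + a) ≤ (4 + i) * D
  2n≤ = begin
    2 * (3 + a)                       ≤⟨ *-monoʳ-≤ 2 (+-monoʳ-≤ 3 a≤) ⟩
    2 * (8 + t)                       ≤⟨ m≤m+n _ _ ⟩
    2 * (8 + t) + (28 + 6 * t + i * D) ≡⟨ e₄ t i D ⟩
    4 * suc (2 * (5 + t)) + i * D     ≡⟨ *-distribʳ-+ D 4 i ⟨
    (4 + i) * D                       ∎
    where
    e₄ : ∀ t i d → 2 * (8 + t) + (28 + 6 * t + i * d) ≡ 4 * suc (2 * (5 + t)) + i * d
    e₄ = solve-∀

-- The least n ≥ m for which K n has an even number of edges; for other n no colouring
-- is balanced when ε = ½.
order : ℕ → ℕ
order 0                         = 0
order 1                         = 1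
order 2                         = 4
order 3                         = 4
order (suc (suc (suc (suc m)))) = 4 + order m

-- Half the number of edges of K n for n = `order m`: four more vertices add 4 n + 6 edges.
half : ℕ → ℕ
half 0                         = 0
half 1                         = 0
half 2                         = 3
half 3                         = 3
half (suc (suc (suc (suc m)))) = 3 + 2 * order m + half m

≤-order : ∀ m → m ≤ order m
≤-order 0                         = z≤n
≤-order 1                         = ≤-refl
≤-order 2                         = s≤s (s≤s z≤n)
≤-order 3                         = s≤s (s≤s (s≤s z≤n))
≤-order (suc (suc (suc (suc m)))) = +-monoʳ-≤ 4 (≤-order m)

order-≤ : ∀ m → order m ≤ 2 + m
order-≤ 0                         = z≤n
order-≤ 1                         = s≤s z≤n
order-≤ 2                         = ≤-refl
order-≤ 3                         = n≤1+n 4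
order-≤ (suc (suc (suc (suc m)))) = +-monoʳ-≤ 4 (order-≤ m)

orderC2 : ∀ m → order m C 2 ≡ 2 * half m
orderC2 0 = refl
orderC2 1 = refl
orderC2 2 = refl
orderC2 3 = refl
orderC2 (suc (suc (suc (suc m)))) = begin
  (4 + v) C 2                                    ≡⟨ [1+n]C2 (3 + v) ⟩
  3 + v + (3 + v) C 2                            ≡⟨ cong (3 + v +_) ([1+n]C2 (2 + v)) ⟩
  3 + v + (2 + v + (2 + v) C 2)                  ≡⟨ cong (λ t → 3 + v + (2 + v + t)) ([1+n]C2 (1 + v)) ⟩
  3 + v + (2 + v + (1 + v + (1 + v) C 2))        ≡⟨ cong (λ t → 3 + v + (2 + v + (1 + v + t))) ([1+n]C2 v) ⟩
  3 + v + (2 + v + (1 + v + (v + v C 2)))        ≡⟨ cong (λ t → 3 + v + (2 + v + (1 + v + (v + t)))) (orderC2 m) ⟩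
  3 + v + (2 + v + (1 + v + (v + 2 * half m)))   ≡⟨ e v (half m) ⟩
  2 * (3 + 2 * v + half m)                       ∎
  where
  open ≡-Reasoning
  v = order m
  e : ∀ n h → 3 + n + (2 + n + (1 + n + (n + 2 * h))) ≡ 2 * (3 + 2 * n + h)
  e = solve-∀

-- Rounding up stops at 4 or 5 for every m from 2 to 5. So n ≥ 2 k ≥ 6 for the rounded order already
-- gives the n₀ ≥ 6 that `C-bound` demands.
6≤order⇒6≤ : ∀ m → 6 ≤ order m → 6 ≤ m
6≤order⇒6≤ 1 (s≤s ())
6≤order⇒6≤ 2 (s≤s (s≤s (s≤s (s≤s ()))))
6≤order⇒6≤ 3 (s≤s (s≤s (s≤s (s≤s ()))))
6≤order⇒6≤ 4 (s≤s (s≤s (s≤s (s≤s ()))))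
6≤order⇒6≤ 5 (s≤s (s≤s (s≤s (s≤s (s≤s ())))))
6≤order⇒6≤ (suc (suc (suc (suc (suc (suc m)))))) _ = +-monoʳ-≤ 6 z≤n

length-cartesianProduct : {A B : Set} (xs : List A) (ys : List B) →
                          length (cartesianProduct xs ys) ≡ length xs * length ys
length-cartesianProduct []       ys = refl
length-cartesianProduct (x ∷ xs) ys = trans (length-++ (map (x ,_) ys))
  (cong₂ _+_ (length-map (x ,_) ys) (length-cartesianProduct xs ys))

edges-unique : ∀ n → Unique (edges n)
edges-unique n = Unique.filter⁺ (λ (i , j) → i Fin.<? j) (Unique.cartesianProduct⁺ (Unique.allFin⁺ n) (Unique.allFin⁺ n))

_≟ᴱ_ : (e e′ : Edge n) → Dec (e ≡ e′)
_≟ᴱ_ = ≡-dec Fin._≟_ Fin._≟_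

disjoint? : (AB : Subset n × Subset n) → Dec (Disjoint (proj₁ AB) (proj₂ AB))
disjoint? (A , B) = Fin.all? (λ i → (lookup A i ∧ lookup B i) Bool.≟ false)

-- The pairs are ordered, so for k > 0 a biclique is listed once for each order of its sides; the
-- bound C(n,k)² on the length covers this.
disjointPairs : ∀ n k → List (Subset n × Subset n)
disjointPairs n k = filter disjoint? (cartesianProduct (subsetsOfSize n k) (subsetsOfSize n k))

cliques bicliques forbidden : ∀ n k → List (Edge n → Bool)
cliques   n k = map clique (subsetsOfSize n k)
bicliques n k = map (λ (A , B) → biclique A B) (disjointPairs n k)
forbidden n k = cliques n k ++ bicliques n k

Avoids : (n k : ℕ) → (Edge n → Bool) → Set
Avoids n k red = ∀ {S} → S ∈ forbidden n k → Escapes red (edges n) S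

avoids⇒no-member : ∀ {n k} (red : Edge n → Bool) → Avoids n k red → ¬ ContainsMember k (fromRed red)
avoids⇒no-member {n} {k} red avoids = no-member {k = k} red
  (λ A ∣A∣≡k → avoids (∈-++⁺ˡ (∈-map⁺ clique (∈-subsetsOfSize⁺ A ∣A∣≡k))))
  (λ A B ∣A∣≡k ∣B∣≡k dis → avoids (∈-++⁺ʳ (cliques n k) (∈-map⁺ (λ (A , B) → biclique A B)
    (∈-filter⁺ disjoint? (∈-cartesianProduct⁺ (∈-subsetsOfSize⁺ A ∣A∣≡k) (∈-subsetsOfSize⁺ B ∣B∣≡k)) dis))))

count-not-fromRed : (red : Edge n → Bool) {h M : ℕ} → n C 2 ≡ 2 * h → count red (edges n) ≡ M → M ≤ h →
                    M ≤ edgeCount (fromRed red) true × h ≤ edgeCount (fromRed red) false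
count-not-fromRed {n} red {h} {M} N≡2h card M≤h =
    ≤-reflexive (sym (trans (proj₁ (edgeCount-fromRed red)) card))
  , subst (h ≤_) (sym (proj₂ (edgeCount-fromRed red))) (+-cancelˡ-≤ M h _ (begin
      M + h                                          ≤⟨ +-monoˡ-≤ h M≤h ⟩
      h + h                                          ≡⟨ cong (h +_) (+-identityʳ h) ⟨
      2 * h                                          ≡⟨ N≡2h ⟨
      n C 2                                          ≡⟨ length-edges n ⟨
      length (edges n)                               ≡⟨ count-not red (edges n) ⟨
      count red (edges n) + count (not ∘ red) (edges n) ≡⟨ cong (_+ count (not ∘ red) (edges n)) card ⟩
      M + count (not ∘ red) (edges n)                ∎))
  where open ≤-Reasoning

-- ε enters only through M and h: M will be chosen so that red reaches ε N, and h = N / 2 serves for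
-- blue because ε ≤ ½.
GoodColouring : (k n M h : ℕ) → Set
GoodColouring k n M h = Σ[ χ ∈ Colouring n ] M ≤ edgeCount χ true × h ≤ edgeCount χ false × ¬ ContainsMember k χ

small-good : ∀ {k n h M} → n < 2 * k → n C 2 ≡ 2 * h → M ≤ h → GoodColouring k n M h
small-good {k} {n} {h} {M} n<2k N≡2h M≤h 
  -- With nothing to avoid, `avoiding` just supplies some set of M red edges.
  with avoiding _≟ᴱ_ (edges-unique n) M []
         (nCk>0 (subst (M ≤_) (sym (trans (length-edges n) N≡2h)) (≤-trans M≤h (m≤m+n h _))))
... | red , card , _ =
  let (r , b) = count-not-fromRed red N≡2h card M≤h in
  fromRed red , r , b , λ (f , _) → <⇒≱ n<2k (Fin.injective⇒≤ (Injection.injective f))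

forbidden-weight : ∀ {k n h L D} → 3 ≤ k → n C 2 ≡ 2 * h → suc L ≤ h → 8 * (2 ^ k * (n C k)) ≤ 3 * D ^ k →
                   D ^ 2 * L ^ (k ∸ 1) ≤ 4 * (n C 2) ^ (k ∸ 1) →
                   weight (forbidden n k) (edges n) (suc L) < length (edges n) C suc L
forbidden-weight {k@(suc k′)} {n} {h} {L} {D} 3≤k N≡2h M≤h few density =
  subst (_< T) (sym (weight-++ (cliques n k) (bicliques n k) (edges n) (suc L)))
    (expected-total {k} {s} {c} {D} {N} {L} (2*[1+n]C2 k′) 3≤k (<-≤-trans z<s 2M≤N) (≤-trans (*-monoʳ-≤ 2 (n≤1+n L)) 2M≤N)
      (subst (λ e → D ^ 2 * L ^ (k ∸ 1) ≤ 4 * e ^ (k ∸ 1)) (sym N≡) density) few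
      {weight (cliques n k) (edges n) (suc L)} {weight (bicliques n k) (edges n) (suc L)}
      (nCk>0 (≤-trans (m≤m+n (suc L) _) 2M≤N)) clique-weight biclique-weight)
  where
  open ≤-Reasoning
  N = length (edges n)
  c = n C k
  s = k C 2
  T = N C suc L
  N≡ : N ≡ n C 2
  N≡ = length-edges n
  2M≤N : 2 * suc L ≤ N
  2M≤N = subst (2 * suc L ≤_) (sym (trans N≡ N≡2h)) (*-monoʳ-≤ 2 M≤h)
  -- This excludes k = 2, where a forbidden clique is a single edge and `supersets-bound` has no
  -- hold.
  3≤s : 3 ≤ s
  3≤s = *-cancelˡ-≤ 2 (subst (6 ≤_) (sym (2*[1+n]C2 k′)) (*-mono-≤ 3≤k (s≤s⁻¹ 3≤k)))
  3≤k² : 3 ≤ k * k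
  3≤k² = ≤-trans 3≤k (m≤m*n k k)
  to-product : ∀ w q → w * (4 * q) ≡ 4 * w * q
  to-product = solve-∀
  clique-weight : weight (cliques n k) (edges n) (suc L) * (4 * N ^ s) ≤ c * (9 * T * L ^ s)
  clique-weight = subst (λ l → weight (cliques n k) (edges n) (suc L) * (4 * N ^ s) ≤ l * (9 * T * L ^ s))
    (trans (length-map clique (subsetsOfSize n k)) (length-subsetsOfSize n k))
    (weight-bound (cliques n k) (edges n) (suc L) bound)
    where
    bound : ∀ {S} → S ∈ cliques n k → supersets S (edges n) (suc L) * (4 * N ^ s) ≤ 9 * T * L ^ s
    bound S∈ with ∈-map⁻ clique S∈
    ... | A , A∈ , refl = subst (_≤ 9 * T * L ^ s) (sym (to-product (supersets (clique A) (edges n) (suc L)) (N ^ s)))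
      (supersets-bound (clique A) (edges n) (trans (count-clique A) (cong (_C 2) (∈-subsetsOfSize⁻ n k A∈))) 3≤s 2M≤N)
  biclique-weight : weight (bicliques n k) (edges n) (suc L) * (4 * N ^ (k * k)) ≤ c * c * (9 * T * L ^ (k * k))
  biclique-weight = ≤-trans (weight-bound (bicliques n k) (edges n) (suc L) bound) (*-monoˡ-≤ (9 * T * L ^ (k * k)) (begin
    length (bicliques n k)                                                      ≡⟨ length-map _ (disjointPairs n k) ⟩
    length (disjointPairs n k)                                                  ≤⟨ length-filter disjoint? (cartesianProduct (subsetsOfSize n k) (subsetsOfSize n k)) ⟩
    length (cartesianProduct (subsetsOfSize n k) (subsetsOfSize n k))           ≡⟨ length-cartesianProduct (subsetsOfSize n k) (subsetsOfSize n k) ⟩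
    length (subsetsOfSize n k) * length (subsetsOfSize n k)                     ≡⟨ cong₂ _*_ (length-subsetsOfSize n k) (length-subsetsOfSize n k) ⟩
    c * c                                                                       ∎))
    where
    bound : ∀ {S} → S ∈ bicliques n k → supersets S (edges n) (suc L) * (4 * N ^ (k * k)) ≤ 9 * T * L ^ (k * k)
    bound S∈ with ∈-map⁻ (λ (A , B) → biclique A B) S∈
    ... | (A , B) , AB∈ , refl with ∈-filter⁻ disjoint? {xs = cartesianProduct (subsetsOfSize n k) (subsetsOfSize n k)} AB∈
    ...   | AB∈′ , dis with ∈-cartesianProduct⁻ (subsetsOfSize n k) (subsetsOfSize n k) AB∈′
    ...     | A∈ , B∈ = subst (_≤ 9 * T * L ^ (k * k)) (sym (to-product (supersets (biclique A B) (edges n) (suc L)) (N ^ (k * k))))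
      (supersets-bound (biclique A B) (edges n)
        (trans (count-biclique A B dis) (cong₂ _*_ (∈-subsetsOfSize⁻ n k A∈) (∈-subsetsOfSize⁻ n k B∈))) 3≤k² 2M≤N)

random-good : ∀ {k n h L D} → 3 ≤ k → n C 2 ≡ 2 * h → suc L ≤ h → 8 * (2 ^ k * (n C k)) ≤ 3 * D ^ k →
         D ^ 2 * L ^ (k ∸ 1) ≤ 4 * (n C 2) ^ (k ∸ 1) → GoodColouring k n (suc L) h
random-good {k} {n} {D = D} 3≤k N≡2h M≤h few density
  with avoiding _≟ᴱ_ (edges-unique n) _ (forbidden n k) (forbidden-weight {k} {n} {D = D} 3≤k N≡2h M≤h few density)
... | red , card , avoids =
  let (r , b) = count-not-fromRed red N≡2h card M≤h in
  fromRed red , r , b , avoids⇒no-member red avoids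

-- The star, for k = 2

isZero : Fin n → Bool
isZero zero    = true
isZero (suc _) = false

isZero-unique : {i j : Fin n} → i ≢ j → isZero i ≡ true → isZero j ≡ false
isZero-unique {i = zero}  {zero}  i≢j _ = contradiction refl i≢j
isZero-unique {i = zero}  {suc _} i≢j _ = refl

star : ∀ n → Edge n → Bool
star n (i , j) = isZero i

star-edge : ∀ {i j : Fin n} → i ≢ j → colour (fromRed (star n)) i j ≡ true → isZero i ≡ true ⊎ isZero j ≡ true
star-edge {i = i} {j} i≢j red with Fin.<-cmp i j
... | tri< _ _ _   = inj₁ red
... | tri≈ _ i≡j _ = contradiction i≡j i≢j
... | tri> _ _ _   = inj₂ red

star-edge⁺ : ∀ {i j : Fin n} → i ≢ j → isZero i ≡ true → colour (fromRed (star n)) i j ≡ true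
star-edge⁺ {i = zero} {zero}  i≢j _ = contradiction refl i≢j
star-edge⁺ {i = zero} {suc j} i≢j _ = refl

two-elements : (A : Subset n) → 2 ≤ ∣ A ∣ → Σ[ a ∈ Fin n ] Σ[ b ∈ Fin n ] a ∈ˢ A × b ∈ˢ A × a ≢ b
two-elements (outside ∷ A) 2≤ with two-elements A 2≤
... | a , b , a∈ , b∈ , a≢b = suc a , suc b , there a∈ , there b∈ , a≢b ∘ Fin.suc-injective
two-elements (inside ∷ A) (s≤s 1≤) with one-element A 1≤
  where
  one-element : ∀ {n} (A : Subset n) → 1 ≤ ∣ A ∣ → Σ[ a ∈ Fin n ] a ∈ˢ A
  one-element (inside  ∷ A) _  = zero , here
  one-element (outside ∷ A) 1≤ with one-element A 1≤
  ... | a , a∈ = suc a , there a∈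
... | b , b∈ = zero , suc b , here , there b∈ , λ ()

-- A star has no two disjoint red edges, yet a and b would be matched in red to x and y if blue
-- formed the cliques. If red formed them, ab would be red with neither end joined in red to x, but
-- one end is the centre.
star-no-member : ¬ ContainsMember 2 (fromRed (star n))
star-no-member {n} (f , c , A , ∣A∣≡2 , classes)
  with two-elements A (≤-reflexive (sym ∣A∣≡2)) | two-elements (∁ A) (≤-reflexive (sym (trans (∣∁p∣≡n∸∣p∣ A) (cong (4 ∸_) ∣A∣≡2))))
... | a , b , a∈ , b∈ , a≢b | x , y , x∈ , y∈ , x≢y = cases c classes
  where
  open Injection f using (to; injective)
  χᶠ = induced (fromRed (star n)) f

  distinct : ∀ {i j} → i ≢ j → to i ≢ to j
  distinct i≢j = i≢j ∘ injective

  crossing : ∀ {i j} → i ∈ˢ A → j ∈ˢ ∁ A → i ≢ j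
  crossing i∈ j∈ refl = x∈p⇒x∉∁p i∈ j∈

  centre : ∀ {i j} → i ≢ j → colour χᶠ i j ≡ true → isZero (to i) ≡ true ⊎ isZero (to j) ≡ true
  centre i≢j = star-edge (distinct i≢j)

  clash : ∀ {i j} → i ≢ j → isZero (to i) ≡ true → isZero (to j) ≡ true → ⊥
  clash i≢j zi zj with () ← trans (sym zj) (isZero-unique (distinct i≢j) zi)

  no-matching : colour χᶠ a x ≡ true → colour χᶠ b y ≡ true → ⊥
  no-matching ax by with centre (crossing a∈ x∈) ax | centre (crossing b∈ y∈) by
  ... | inj₁ za | inj₁ zb = clash a≢b za zb
  ... | inj₁ za | inj₂ zy = clash (crossing a∈ y∈) za zy
  ... | inj₂ zx | inj₁ zb = clash (crossing b∈ x∈) zb zx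
  ... | inj₂ zx | inj₂ zy = clash x≢y zx zy

  not-isolated : colour χᶠ a b ≡ true → (∀ {i} → i ∈ˢ A → colour χᶠ i x ≢ true) → ⊥
  not-isolated ab blue with centre a≢b ab
  ... | inj₁ za = blue a∈ (star-edge⁺ (distinct (crossing a∈ x∈)) za)
  ... | inj₂ zb = blue b∈ (star-edge⁺ (distinct (crossing b∈ x∈)) zb)

  across : ∀ {i j} → i ∈ˢ A → j ∈ˢ ∁ A → Within A i j ⊎ Within (∁ A) i j → ⊥
  across i∈ j∈ (inj₁ (_ , j∈A))  = x∈∁p⇒x∉p j∈ j∈A
  across i∈ j∈ (inj₂ (i∈∁A , _)) = x∈∁p⇒x∉p i∈∁A i∈

  cases : ∀ c → ColourClass χᶠ c (Within A) ⊎ ColourClass χᶠ c (λ i j → Within A i j ⊎ Within (∁ A) i j) → ⊥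
  cases true (inj₁ cl) = not-isolated (Equivalence.from (cl a b a≢b) (a∈ , b∈))
    (λ i∈ red → across i∈ x∈ (inj₁ (Equivalence.to (cl _ x (crossing i∈ x∈)) red)))
  cases true (inj₂ cl) = not-isolated (Equivalence.from (cl a b a≢b) (inj₁ (a∈ , b∈)))
    (λ i∈ red → across i∈ x∈ (Equivalence.to (cl _ x (crossing i∈ x∈)) red))
  cases false (inj₁ cl) = no-matching
    (Bool.¬-not (λ blue → across a∈ x∈ (inj₁ (Equivalence.to (cl a x (crossing a∈ x∈)) blue))))
    (Bool.¬-not (λ blue → across b∈ y∈ (inj₁ (Equivalence.to (cl b y (crossing b∈ y∈)) blue))))
  cases false (inj₂ cl) = no-matching
    (Bool.¬-not (λ blue → across a∈ x∈ (Equivalence.to (cl a x (crossing a∈ x∈)) blue)))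
    (Bool.¬-not (λ blue → across b∈ y∈ (Equivalence.to (cl b y (crossing b∈ y∈)) blue)))

count-star : ∀ n → count (star (suc n)) (edges (suc n)) ≡ n
count-star n = trans (count-edges-suc (star (suc n)))
  (trans (cong₂ _+_ (trans (count-true (allFin n)) (length-tabulate id)) (count-false (edges n))) (+-identityʳ n))

-- For k = 2 the density condition reads D² L ≤ 2 n (n - 1), so 2 n < D² gives L < n - 1: the n - 1
-- edges of the star suffice for red. From n ≥ 4 on they are at most half of all edges.
star-good : ∀ {n h L D} → 4 ≤ n → n C 2 ≡ 2 * h → 2 * n < D ^ 2 → D ^ 2 * L ≤ 4 * (n C 2) → GoodColouring 2 n (suc L) h
star-good {suc n} {h} {L} {D} (s≤s 3≤n) N≡2h 2n<D² density =
  let (r , b) = count-not-fromRed (star (suc n)) N≡2h (count-star n) n≤h in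
  fromRed (star (suc n)) , ≤-trans L<n r , b , star-no-member
  where
  open ≤-Reasoning
  n≤h : n ≤ h
  n≤h = *-cancelˡ-≤ 4 (begin
    4 * n               ≤⟨ *-monoˡ-≤ n (s≤s 3≤n) ⟩
    suc n * n           ≡⟨ 2*[1+n]C2 n ⟨
    2 * (suc n C 2)     ≡⟨ cong (2 *_) N≡2h ⟩
    2 * (2 * h)         ≡⟨ *-assoc 2 2 h ⟨
    4 * h               ∎)
  L<n : L < n
  L<n = *-cancelˡ-< (D ^ 2) L n (begin-strict
    D ^ 2 * L             ≤⟨ density ⟩
    4 * (suc n C 2)       ≡⟨ *-assoc 2 2 (suc n C 2) ⟩
    2 * (2 * (suc n C 2)) ≡⟨ cong (2 *_) (2*[1+n]C2 n) ⟩
    2 * (suc n * n)       ≡⟨ *-assoc 2 (suc n) n ⟨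
    2 * suc n * n         <⟨ *-monoˡ-< n {{>-nonZero (<-≤-trans z<s 3≤n)}} 2n<D² ⟩
    D ^ 2 * n             ∎)

order-star : ∀ m L → 4 ≤ order (suc m) → suc (2 * m) ^ 2 * L ^ 1 ≤ 4 * (order (suc m) C 2) ^ 1 →
             GoodColouring 2 (order (suc m)) (suc L ⊓ half (suc m)) (half (suc m))
order-star zero    L (s≤s ()) density
order-star (suc t) L 4≤n density
  with star-good {order (2 + t)} {half (2 + t)} {L} {suc (2 * suc t)} 4≤n (orderC2 (2 + t)) 2n<D²
         (subst₂ (λ l c → suc (2 * suc t) ^ 2 * l ≤ 4 * c) (*-identityʳ L) (*-identityʳ (order (2 + t) C 2)) density)
  where
  2n<D² : 2 * order (2 + t) < suc (2 * suc t) ^ 2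
  2n<D² = begin-strict
    2 * order (2 + t)                            ≤⟨ *-monoʳ-≤ 2 (order-≤ (2 + t)) ⟩
    -- At t = 0 there is no room to spare: n = 4 and D = 3 give 8 < 9.
    2 * (4 + t)                                  <⟨ n<1+n _ ⟩
    suc (2 * (4 + t))                            ≤⟨ m≤m+n _ _ ⟩
    suc (2 * (4 + t)) + (4 * (t * t) + 10 * t)   ≡⟨ e t ⟩
    suc (2 * suc t) * (suc (2 * suc t) * 1)      ∎
    where
    open ≤-Reasoning
    e : ∀ t → suc (2 * (4 + t)) + (4 * (t * t) + 10 * t) ≡ suc (2 * suc t) * (suc (2 * suc t) * 1)
    e = solve-∀
... | χ , r , b , none = χ , ≤-trans (m⊓n≤m (suc L) (half (2 + t))) r , b , none

order-random : ∀ {k m} L → 3 ≤ k → 6 ≤ order (suc m) → suc (2 * m) ^ 2 * L ^ (k ∸ 1) ≤ 4 * (order (suc m) C 2) ^ (k ∸ 1) →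
               GoodColouring k (order (suc m)) (suc L ⊓ half (suc m)) (half (suc m))
order-random {k} {m} L 3≤k 6≤n density with half (suc m) in eq
... | zero  = contradiction (subst (0 <_) (trans (orderC2 (suc m)) (cong (2 *_) eq)) (nCk>0 (≤-trans (s≤s (s≤s z≤n)) 6≤n))) (λ ())
-- The cap at half of the edges commutes with the successor, so L ⊓ h takes the place of L; a
-- smaller L only helps the density condition.
... | suc h = random-good {k} {order (suc m)} {suc h} {L ⊓ h} {suc (2 * m)} 3≤k (trans (orderC2 (suc m)) (cong (2 *_) eq))
  (s≤s (m⊓n≤n L h)) few (≤-trans (*-monoʳ-≤ (suc (2 * m) ^ 2) (^-monoˡ-≤ (k ∸ 1) (m⊓n≤m L h))) density)
  where
  few : 8 * (2 ^ k * (order (suc m) C k)) ≤ 3 * suc (2 * m) ^ k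
  few = subst₂ (λ d k → 8 * (2 ^ k * (order (suc m) C k)) ≤ 3 * suc (2 * d) ^ k)
    (m+[n∸m]≡n {5} {m} (s≤s⁻¹ (6≤order⇒6≤ (suc m) 6≤n))) (m+[n∸m]≡n 3≤k)
    (subst (λ v → 8 * (2 ^ (3 + (k ∸ 3)) * (v C (3 + (k ∸ 3)))) ≤ 3 * suc (2 * (5 + (m ∸ 5))) ^ (3 + (k ∸ 3)))
      (m+[n∸m]≡n {3} {order (suc m)} (≤-trans (s≤s (s≤s (s≤s z≤n))) 6≤n))
      (C-bound (m ∸ 5) (order (suc m) ∸ 3) (k ∸ 3)
        (subst (order (suc m) ∸ 3 ≤_) (sym (m+[n∸m]≡n {5} {m} (s≤s⁻¹ (6≤order⇒6≤ (suc m) 6≤n))))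
          (∸-monoˡ-≤ 3 (order-≤ (suc m))))))

-- With n₀ = `suc m` and N the number of edges, the hypothesis is (n₀ - ½)² (L / N)^(k-1) ≤ 1
-- cleared of denominators.
good-colouring : ∀ k m L → 2 ≤ k → suc (2 * m) ^ 2 * L ^ (k ∸ 1) ≤ 4 * (order (suc m) C 2) ^ (k ∸ 1) →
                 GoodColouring k (order (suc m)) (suc L ⊓ half (suc m)) (half (suc m))
good-colouring k m L 2≤k density with order (suc m) <? 2 * k
... | yes n<2k = small-good n<2k (orderC2 (suc m)) (m⊓n≤n (suc L) (half (suc m)))
good-colouring 2 m L _ density | no n≮2k = order-star m L (≮⇒≥ n≮2k) density
good-colouring (suc zero) m L (s≤s ()) density | no n≮2k
good-colouring (suc (suc (suc i))) m L _ density | no n≮2k =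
  order-random {m = m} L 3≤k (≤-trans (*-monoʳ-≤ 2 3≤k) (≮⇒≥ n≮2k)) density
  where
  3≤k : 3 ≤ 3 + i
  3≤k = m≤m+n 3 i

-- From real ε to natural numbers

open ℝ

2ℚ : ℚ
2ℚ = 1ℚ ℚ.+ 1ℚ

ratio-+ : ∀ m n → ratio (m + n) ≡ ratio m ℚ.+ ratio n
ratio-+ zero    n = sym (ℚ.+-identityˡ (ratio n))
ratio-+ (suc m) n = begin
  ratio (suc (m + n))               ≡⟨ ratio-suc (m + n) ⟩
  1ℚ ℚ.+ ratio (m + n)              ≡⟨ cong (1ℚ ℚ.+_) (ratio-+ m n) ⟩
  1ℚ ℚ.+ (ratio m ℚ.+ ratio n)      ≡⟨ ℚ.+-assoc 1ℚ (ratio m) (ratio n) ⟨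
  1ℚ ℚ.+ ratio m ℚ.+ ratio n        ≡⟨ cong (ℚ._+ ratio n) (ratio-suc m) ⟨
  ratio (suc m) ℚ.+ ratio n         ∎
  where open ≡-Reasoning

ratio-* : ∀ m n → ratio (m * n) ≡ ratio m ℚ.* ratio n
ratio-* zero    n = sym (ℚ.*-zeroˡ (ratio n))
ratio-* (suc m) n = begin
  ratio (n + m * n)                    ≡⟨ ratio-+ n (m * n) ⟩
  ratio n ℚ.+ ratio (m * n)            ≡⟨ cong (ratio n ℚ.+_) (ratio-* m n) ⟩
  ratio n ℚ.+ ratio m ℚ.* ratio n      ≡⟨ solve 2 (λ m n → n :+ m :* n := (con 1ℚ :+ m) :* n) refl (ratio m) (ratio n) ⟩
  (1ℚ ℚ.+ ratio m) ℚ.* ratio n         ≡⟨ cong (ℚ._* ratio n) (ratio-suc m) ⟨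
  ratio (suc m) ℚ.* ratio n            ∎
  where
  open ≡-Reasoning
  open +-*-Solver

0≤ratio : ∀ n → 0ℚ ℚ.≤ ratio n
0≤ratio zero    = ℚ.≤-refl
0≤ratio (suc n) = subst (0ℚ ℚ.≤_) (sym (ratio-suc n)) (ℚ.≤-trans (ℚ.<⇒≤ Defs.0<1) (Defs.p≤p+q 1ℚ (0≤ratio n)))

ratio-mono-≤ : ∀ {m n} → m ≤ n → ratio m ℚ.≤ ratio n
ratio-mono-≤ {m} {n} m≤n = subst (ratio m ℚ.≤_) (trans (sym (ratio-+ m (n ∸ m))) (cong ratio (m+[n∸m]≡n m≤n)))
  (Defs.p≤p+q (ratio m) (0≤ratio (n ∸ m)))

≤-ratio-⊓ : ∀ m n {p} → p ℚ.≤ ratio m → p ℚ.≤ ratio n → p ℚ.≤ ratio (m ⊓ n)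
≤-ratio-⊓ m n {p} p≤m p≤n with ⊓-sel m n
... | inj₁ e = subst (λ t → p ℚ.≤ ratio t) (sym e) p≤m
... | inj₂ e = subst (λ t → p ℚ.≤ ratio t) (sym e) p≤n

ratio-<-suc : ∀ n → ratio n ℚ.< ratio (suc n)
ratio-<-suc n = subst (ratio n ℚ.<_) (trans (ℚ.+-comm (ratio n) 1ℚ) (sym (ratio-suc n))) (Defs.p<p+q (ratio n) Defs.0<1)

ratio-cancel-≤ : ∀ {m n} → ratio m ℚ.≤ ratio n → m ≤ n
ratio-cancel-≤ {m} {n} le = ≮⇒≥ λ n<m → ℚ.<-irrefl refl (ℚ.<-≤-trans (ratio-<-suc n) (ℚ.≤-trans (ratio-mono-≤ {suc n} {m} n<m) le))

-- Rational powers and rounding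

infixr 8 _^ꟴ_

_^ꟴ_ : ℚ → ℕ → ℚ
p ^ꟴ zero  = 1ℚ
p ^ꟴ suc k = p ℚ.* p ^ꟴ k

ratio-^ : ∀ n k → ratio (n ^ k) ≡ ratio n ^ꟴ k
ratio-^ n zero    = refl
ratio-^ n (suc k) = trans (ratio-* n (n ^ k)) (cong (ratio n ℚ.*_) (ratio-^ n k))

^ꟴ-nonNeg : ∀ {p} → 0ℚ ℚ.≤ p → ∀ k → 0ℚ ℚ.≤ p ^ꟴ k
^ꟴ-nonNeg 0≤p zero    = ℚ.<⇒≤ Defs.0<1
^ꟴ-nonNeg 0≤p (suc k) = Defs.*-nonNeg 0≤p (^ꟴ-nonNeg 0≤p k)

^ꟴ-mono-≤ : ∀ {p q} → 0ℚ ℚ.≤ p → p ℚ.≤ q → ∀ k → p ^ꟴ k ℚ.≤ q ^ꟴ k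
^ꟴ-mono-≤ 0≤p p≤q zero    = ℚ.≤-refl
^ꟴ-mono-≤ {p} {q} 0≤p p≤q (suc k) =
  ℚ.≤-trans (Defs.*-monoʳ-≤ p 0≤p (^ꟴ-mono-≤ 0≤p p≤q k))
            (Defs.*-monoˡ-≤ (q ^ꟴ k) (^ꟴ-nonNeg (ℚ.≤-trans 0≤p p≤q) k) p≤q)

^ꟴ-distribʳ-* : ∀ p q k → (p ℚ.* q) ^ꟴ k ≡ p ^ꟴ k ℚ.* q ^ꟴ k
^ꟴ-distribʳ-* p q zero    = refl
^ꟴ-distribʳ-* p q (suc k) = trans (cong (p ℚ.* q ℚ.*_) (^ꟴ-distribʳ-* p q k))
  (solve 4 (λ p q a b → p :* q :* (a :* b) := p :* a :* (q :* b)) refl p q (p ^ꟴ k) (q ^ꟴ k))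
  where open +-*-Solver

-- `suc L` will be the number of red edges before capping. It has to reach q, while the density
-- estimate needs L itself to stay at or below q.
ceiling : ∀ q → 0ℚ ℚ.≤ q → ∃[ L ] q ℚ.≤ ratio (suc L) × ratio L ℚ.≤ q
ceiling q 0≤q = search ℤ.∣ ℚ.↥ q ∣ (ratio-bound q)
  where
  search : ∀ B → q ℚ.≤ ratio B → ∃[ L ] q ℚ.≤ ratio (suc L) × ratio L ℚ.≤ q
  search zero    q≤ = 0 , ℚ.≤-trans q≤ (ratio-mono-≤ {0} {1} z≤n) , 0≤q
  search (suc B) q≤ with q ℚ.≤? ratio B
  ... | yes q≤B = search B q≤B
  ... | no  q≰B = B , q≤ , ℚ.<⇒≤ (ℚ.≰⇒> q≰B)

*-factor-pos : ∀ {p q} → 0ℚ ℚ.< q → 0ℚ ℚ.< p ℚ.* q → 0ℚ ℚ.< p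
*-factor-pos {p} {q} 0<q 0<pq = Defs.*-cancelʳ-< q 0<q (subst (ℚ._< p ℚ.* q) (sym (ℚ.*-zeroˡ q)) 0<pq)

U-⊓ : ∀ x {p q} → U x p → U x q → U x (p ℚ.⊓ q)
U-⊓ x {p} {q} Up Uq with ℚ.⊓-sel p q
... | inj₁ e = subst (U x) (sym e) Up
... | inj₂ e = subst (U x) (sym e) Uq

module _ (ε : ℝ) (0<ε : fromℚ 0ℚ <ᴿ ε) where

  upper-pos : ∀ {r} → U ε r → 0ℚ ℚ.< r
  upper-pos Ur = ℚ.<-trans (proj₁ (proj₂ 0<ε)) (Defs.L<U ε (proj₂ (proj₂ 0<ε)) Ur)

  -- A lower bound q on a product of cuts comes with q < a c, where a lies below 1/ε and c below the
  -- smaller power. The minimum of the rationals r₁ and r₂ that witness this for a and c serves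
  -- both. For q ≤ 0 any r above ε will do.
  below-inverse-power : ∀ j q → L (inverse ε 0<ε ^ᴿ j) q → ∃[ r ] U ε r × q ℚ.* r ^ꟴ j ℚ.< 1ℚ
  below-inverse-power zero q q<1 with U-inh ε
  ... | r , Ur = r , Ur , subst (ℚ._< 1ℚ) (sym (ℚ.*-identityʳ q)) q<1
  below-inverse-power (suc j) q (a , b , c , d , ((r₁ , Ur₁ , ar₁<1) , (s , _ , 0<s , 1<bs) , Lc , _) , q<min) with 0ℚ ℚ.<? q
  ... | no 0≮q = r₁ , Ur₁ , ℚ.≤-<-trans
    (subst (q ℚ.* r₁ ^ꟴ suc j ℚ.≤_) (ℚ.*-zeroˡ (r₁ ^ꟴ suc j))
      (Defs.*-monoˡ-≤ (r₁ ^ꟴ suc j) (^ꟴ-nonNeg (ℚ.<⇒≤ (upper-pos Ur₁)) (suc j)) (ℚ.≮⇒≥ 0≮q))) Defs.0<1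
  ... | yes 0<q with below-inverse-power j c Lc
  ...   | r₂ , Ur₂ , cr₂<1 = r , Ur , (begin-strict
      q ℚ.* (r ℚ.* r ^ꟴ j)               <⟨ Defs.*-monoˡ-< (r ℚ.* r ^ꟴ j) 0<rr q<ac ⟩
      a ℚ.* c ℚ.* (r ℚ.* r ^ꟴ j)         ≡⟨ solve 4 (λ a c r s → a :* c :* (r :* s) := a :* r :* (c :* s)) refl a c r (r ^ꟴ j) ⟩
      a ℚ.* r ℚ.* (c ℚ.* r ^ꟴ j)         ≤⟨ Defs.*-monoˡ-≤ (c ℚ.* r ^ꟴ j) (Defs.*-nonNeg (ℚ.<⇒≤ 0<c) (^ꟴ-nonNeg 0≤r j)) ar≤1 ⟩
      1ℚ ℚ.* (c ℚ.* r ^ꟴ j)              ≤⟨ Defs.*-monoʳ-≤ 1ℚ (ℚ.<⇒≤ Defs.0<1) crʲ≤1 ⟩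
      1ℚ ℚ.* 1ℚ                          ≡⟨⟩
      1ℚ                                 ∎)
    where
    open ℚ.≤-Reasoning
    open +-*-Solver
    r = r₁ ℚ.⊓ r₂
    Ur : U ε r
    Ur = U-⊓ ε Ur₁ Ur₂
    0≤r : 0ℚ ℚ.≤ r
    0≤r = ℚ.<⇒≤ (upper-pos Ur)
    0<rr : 0ℚ ℚ.< r ^ꟴ suc j
    0<rr = pow-pos (suc j)
      where
      pow-pos : ∀ i → 0ℚ ℚ.< r ^ꟴ i
      pow-pos zero    = Defs.0<1
      pow-pos (suc i) = Defs.*-pos (upper-pos Ur) (pow-pos i)
    q<ac : q ℚ.< a ℚ.* c
    q<ac = ℚ.<-≤-trans q<min (ℚ.≤-trans (ℚ.p⊓q≤p (a ℚ.* c ℚ.⊓ (a ℚ.* d)) (b ℚ.* c ℚ.⊓ (b ℚ.* d))) (ℚ.p⊓q≤p (a ℚ.* c) (a ℚ.* d)))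
    q<bc : q ℚ.< b ℚ.* c
    q<bc = ℚ.<-≤-trans q<min (ℚ.≤-trans (ℚ.p⊓q≤q (a ℚ.* c ℚ.⊓ (a ℚ.* d)) (b ℚ.* c ℚ.⊓ (b ℚ.* d))) (ℚ.p⊓q≤p (b ℚ.* c) (b ℚ.* d)))
    -- The signs of a and c come from the other corner: b lies above 1/ε and is positive, then b c >
    -- q > 0 makes c positive, and a c > q > 0 makes a positive.
    0<b : 0ℚ ℚ.< b
    0<b = *-factor-pos 0<s (ℚ.<-trans Defs.0<1 1<bs)
    0<c : 0ℚ ℚ.< c
    0<c = *-factor-pos 0<b (subst (0ℚ ℚ.<_) (ℚ.*-comm b c) (ℚ.<-trans 0<q q<bc))
    0<a : 0ℚ ℚ.< a
    0<a = *-factor-pos 0<c (ℚ.<-trans 0<q q<ac)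
    ar≤1 : a ℚ.* r ℚ.≤ 1ℚ
    ar≤1 = ℚ.≤-trans (Defs.*-monoʳ-≤ a (ℚ.<⇒≤ 0<a) (ℚ.p⊓q≤p r₁ r₂)) (ℚ.<⇒≤ ar₁<1)
    crʲ≤1 : c ℚ.* r ^ꟴ j ℚ.≤ 1ℚ
    crʲ≤1 = ℚ.≤-trans (Defs.*-monoʳ-≤ c (ℚ.<⇒≤ 0<c) (^ꟴ-mono-≤ 0≤r (ℚ.p⊓q≤q r₁ r₂) j)) (ℚ.<⇒≤ cr₂<1)

-- The point (a , N) lies in the rational rectangle that witnesses a lower bound on the product, so
-- testing rationals a below ε is enough.
product-≤ : ∀ ε N E → (∀ {a} → L ε a → a ℚ.* ratio N ℚ.≤ ratio E) → ε *ᴿ fromℕ N ≤ᴿ fromℕ E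
product-≤ ε N E le q (a , b , c , d , (La , Ub , c<N , N<d) , q<min) =
  ℚ.<-≤-trans q<min (ℚ.≤-trans
    (proj₁ (Defs.rectangle a (ratio N) ℚ.≤-refl (ℚ.<⇒≤ (Defs.L<U ε La Ub)) (ℚ.<⇒≤ c<N) (ℚ.<⇒≤ N<d))) (le La))

odd-ratio : ∀ m → ratio (suc (2 * m)) ≡ 2ℚ ℚ.* (ratio m ℚ.+ ½)
odd-ratio m = trans (ratio-suc (2 * m)) (trans (cong (1ℚ ℚ.+_) (ratio-* 2 m))
  (solve 1 (λ x → con 1ℚ :+ con 2ℚ :* x := con 2ℚ :* (x :+ con ½)) refl (ratio m)))
  where open +-*-Solver

-- As 2 m + 1 = 2 (m + ½) and L ≤ r N, the rational inequality multiplied by 4 N^j becomes one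
-- between natural numbers.
density-bound : ∀ {m N L j r} → 0ℚ ℚ.≤ r → ratio L ℚ.≤ r ℚ.* ratio N →
                (ratio m ℚ.+ ½) ℚ.* (ratio m ℚ.+ ½) ℚ.* r ^ꟴ j ℚ.< 1ℚ →
                suc (2 * m) ^ 2 * L ^ j ≤ 4 * N ^ j
density-bound {m} {N} {L} {j} {r} 0≤r L≤ lt = ratio-cancel-≤ (begin
  ratio (suc (2 * m) ^ 2 * L ^ j)                           ≡⟨ ratio-* (suc (2 * m) ^ 2) (L ^ j) ⟩
  ratio (suc (2 * m) ^ 2) ℚ.* ratio (L ^ j)                 ≡⟨ cong₂ ℚ._*_ (trans (ratio-^ (suc (2 * m)) 2) (cong (_^ꟴ 2) (odd-ratio m))) (ratio-^ L j) ⟩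
  (2ℚ ℚ.* p) ^ꟴ 2 ℚ.* ratio L ^ꟴ j                          ≤⟨ Defs.*-monoʳ-≤ ((2ℚ ℚ.* p) ^ꟴ 2) 0≤2p² (^ꟴ-mono-≤ (0≤ratio L) L≤ j) ⟩
  (2ℚ ℚ.* p) ^ꟴ 2 ℚ.* (r ℚ.* ratio N) ^ꟴ j                  ≡⟨ cong ((2ℚ ℚ.* p) ^ꟴ 2 ℚ.*_) (^ꟴ-distribʳ-* r (ratio N) j) ⟩
  (2ℚ ℚ.* p) ^ꟴ 2 ℚ.* (r ^ꟴ j ℚ.* ratio N ^ꟴ j)             ≡⟨ solve 3 (λ p x y → con 2ℚ :* p :* (con 2ℚ :* p :* con 1ℚ) :* (x :* y) := con 2ℚ :* con 2ℚ :* y :* (p :* p :* x)) refl p (r ^ꟴ j) (ratio N ^ꟴ j) ⟩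
  2ℚ ℚ.* 2ℚ ℚ.* ratio N ^ꟴ j ℚ.* (p ℚ.* p ℚ.* r ^ꟴ j)       ≤⟨ Defs.*-monoʳ-≤ _ (Defs.*-nonNeg (ℚ.nonNegative⁻¹ (2ℚ ℚ.* 2ℚ)) (^ꟴ-nonNeg (0≤ratio N) j)) (ℚ.<⇒≤ lt) ⟩
  2ℚ ℚ.* 2ℚ ℚ.* ratio N ^ꟴ j ℚ.* 1ℚ                         ≡⟨ ℚ.*-identityʳ _ ⟩
  ratio 4 ℚ.* ratio N ^ꟴ j                                  ≡⟨ cong (ratio 4 ℚ.*_) (ratio-^ N j) ⟨
  ratio 4 ℚ.* ratio (N ^ j)                                 ≡⟨ ratio-* 4 (N ^ j) ⟨
  ratio (4 * N ^ j)                                         ∎)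
  where
  open ℚ.≤-Reasoning
  open +-*-Solver
  p = ratio m ℚ.+ ½
  0≤p : 0ℚ ℚ.≤ p
  0≤p = ℚ.≤-trans (0≤ratio m) (Defs.p≤p+q (ratio m) (ℚ.nonNegative⁻¹ ½))
  0≤2p² : 0ℚ ℚ.≤ (2ℚ ℚ.* p) ^ꟴ 2
  0≤2p² = ^ꟴ-nonNeg (Defs.*-nonNeg (ℚ.nonNegative⁻¹ 2ℚ) 0≤p) 2

module _ (ε : ℝ) (0<ε : fromℚ 0ℚ <ᴿ ε) (ε≤½ : ε ≤ᴿ fromℚ ½) (k : ℕ) (2≤k : 2 ≤ k) where

  -- K 0 has no edges, so its colouring is balanced for every ε, but it has no room for 2 k
  -- vertices.
  not-unavoidable-0 : ¬ Unavoidable k ε 0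
  not-unavoidable-0 unavoidable =
    no-injection (unavoidable 0 z≤n empty (λ c → product-≤ ε 0 (edgeCount empty c) (λ {a} _ → ℚ.≤-reflexive (ℚ.*-zeroʳ a))))
    where
    empty : Colouring 0
    empty = record { colour = λ () ; symmetric = λ () }
    no-injection : ¬ ContainsMember k empty
    no-injection (f , _) with () ← Injection.to f (Fin.fromℕ< (≤-trans (≤-trans (s≤s z≤n) 2≤k) (m≤m+n k _)))

  -- The counterexample has `order (suc m)` vertices, at least `suc m` as `Unavoidable` requires.
  -- Working with a rational r above ε makes the rounding of r N decidable.
  not-unavoidable-suc : ∀ m {r} → U ε r → (ratio m ℚ.+ ½) ℚ.* (ratio m ℚ.+ ½) ℚ.* r ^ꟴ (k ∸ 1) ℚ.< 1ℚ →
                        ¬ Unavoidable k ε (suc m)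
  not-unavoidable-suc m {r} Ur lt unavoidable =
    refute (good-colouring k m (proj₁ c) 2≤k (density-bound {m} {N} {proj₁ c} {k ∸ 1} 0≤r (proj₂ (proj₂ c)) lt))
    where
    N = order (suc m) C 2
    h = half (suc m)
    0≤r : 0ℚ ℚ.≤ r
    0≤r = ℚ.<⇒≤ (upper-pos ε 0<ε Ur)
    c : ∃[ L ] r ℚ.* ratio N ℚ.≤ ratio (suc L) × ratio L ℚ.≤ r ℚ.* ratio N
    c = ceiling (r ℚ.* ratio N) (Defs.*-nonNeg 0≤r (0≤ratio N))

    εN≤h : ∀ {a} → L ε a → a ℚ.* ratio N ℚ.≤ ratio h
    εN≤h {a} La = ℚ.≤-trans (Defs.*-monoˡ-≤ (ratio N) (0≤ratio N) (ℚ.<⇒≤ (ε≤½ a La))) (ℚ.≤-reflexive (begin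
      ½ ℚ.* ratio N           ≡⟨ cong (λ t → ½ ℚ.* ratio t) (orderC2 (suc m)) ⟩
      ½ ℚ.* ratio (2 * h)     ≡⟨ cong (½ ℚ.*_) (ratio-* 2 h) ⟩
      ½ ℚ.* (2ℚ ℚ.* ratio h)  ≡⟨ solve 1 (λ x → con ½ :* (con 2ℚ :* x) := x) refl (ratio h) ⟩
      ratio h                 ∎))
      where
      open ≡-Reasoning
      open +-*-Solver

    εN≤M : ∀ {a} → L ε a → a ℚ.* ratio N ℚ.≤ ratio (suc (proj₁ c) ⊓ h)
    εN≤M {a} La = ≤-ratio-⊓ (suc (proj₁ c)) h
      (ℚ.≤-trans (Defs.*-monoˡ-≤ (ratio N) (0≤ratio N) (ℚ.<⇒≤ (Defs.L<U ε La Ur))) (proj₁ (proj₂ c))) (εN≤h La)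

    refute : ¬ GoodColouring k (order (suc m)) (suc (proj₁ c) ⊓ h) h
    refute (χ , red , blue , none) = none (unavoidable (order (suc m)) (≤-order (suc m)) χ balanced)
      where
      balanced : Balanced ε χ
      balanced true  = product-≤ ε N (edgeCount χ true) (λ La → ℚ.≤-trans (εN≤M La) (ratio-mono-≤ {suc (proj₁ c) ⊓ h} {edgeCount χ true} red))
      balanced false = product-≤ ε N (edgeCount χ false) (λ La → ℚ.≤-trans (εN≤h La) (ratio-mono-≤ {h} {edgeCount χ false} blue))

  -- Refuting already n₀ - ½ < ε^(-(k-1)/2) leaves the room in which the cut can be located.
  unavoidable-bound : ∀ n₀ → Unavoidable k ε n₀ → √ (inverse ε 0<ε ^ᴿ (k ∸ 1)) <ᴿ fromℕ n₀
  unavoidable-bound zero    unavoidable = contradiction unavoidable not-unavoidable-0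
  unavoidable-bound (suc m) unavoidable = decide (located root p<n₀)
    where
    root = √ (inverse ε 0<ε ^ᴿ (k ∸ 1))
    p = ratio m ℚ.+ ½
    p<n₀ : p ℚ.< ratio (suc m)
    p<n₀ = subst (p ℚ.<_) (trans (ℚ.+-comm (ratio m) 1ℚ) (sym (ratio-suc m))) (ℚ.+-monoʳ-< (ratio m) {½} {1ℚ} (ℚ.*<* (ℤ.+<+ ≤-refl)))
    0<p : 0ℚ ℚ.< p
    0<p = ℚ.≤-<-trans (0≤ratio m) (Defs.p<p+q (ratio m) (ℚ.positive⁻¹ ½))
    decide : L root p ⊎ U root (ratio (suc m)) → root <ᴿ fromℕ (suc m)
    decide (inj₁ (inj₁ p<0)) = contradiction p<0 (ℚ.<-asym 0<p)
    -- Here n₀ - ½ lies below the root, and a rational r > ε with (n₀ - ½)² r^(k-1) < 1 witnesses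
    -- it.
    decide (inj₁ (inj₂ Lp²)) =
      let (r , Ur , lt) = below-inverse-power ε 0<ε (k ∸ 1) (p ℚ.* p) Lp² in
      contradiction unavoidable (not-unavoidable-suc m Ur lt)
    decide (inj₂ Un₀) = let (q , q<n₀ , Uq) = U-open root Un₀ in q , Uq , q<n₀

proposition2p3 :
    (ε : ℝ) (0<ε : fromℚ 0ℚ <ᴿ ε) → ε ≤ᴿ fromℚ ½ →
    (k : ℕ) → 2 ≤ k →
    (n₀ : ℕ) → IsThreshold k ε n₀ →
    √ (inverse ε 0<ε ^ᴿ (k ∸ 1)) <ᴿ fromℕ n₀
proposition2p3 ε 0<ε ε≤½ k 2≤k n₀ (unavoidable , _) = unavoidable-bound ε 0<ε ε≤½ k 2≤k n₀ unavoidable
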